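{- Let $\ell$ be a non-negative integer and fix a tree degree sequence. Among all trees with this degree sequence, the greedy tree maximizes the number of vertices $z$ with $\operatorname{ecc}_T(z)\leq\ell$. In particular, the greedy tree minimizes $\operatorname{Ecc}(T)$ among trees with the given degree sequence.
   Context: For a vertex $v$ of a tree $T$, $\operatorname{ecc}_T(v)=\max_{u\in V(T)} d_T(u,v)$, and $\operatorname{Ecc}(T)=\sum_{z\in V(T)}\operatorname{ecc}_T(z)$. Greedy tree: given a tree degree sequence $d_1\geq d_2\geq\cdots\geq d_n$ in non-increasing order, build a rooted tree level by level: the root has degree $d_1$; the $d_1$ vertices at height 1 receive the next largest degrees $d_2,\ldots,d_{d_1+1}$; in general the vertices at height $i+1$ (whose number is the sum over vertices $x$ at height $i\geq1$ of $\deg(x)-1$) receive the next largest unused degrees, so that every degree at a level is at most every degree at the previous level. Within each level vertices are ordered left to right by non-increasing degree, and, processing the vertices of each level from left to right, each vertex is joined to the first as yet unconnected vertices of the next level, as many as its down-degree (degree for the root, degree minus one otherwise). -}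

module Defs where

open import Data.Nat using (ℕ; zero; suc; _+_; _∸_; _≤_; _<_; _≤ᵇ_; _<ᵇ_; _⊔_)
open import Data.Bool using (Bool; true; false; _∧_; _∨_; if_then_else_; T)
open import Data.Fin using (Fin; toℕ; _≟_)
open import Data.List using (List; []; _∷_; _++_; map; foldr; upTo; allFin; length)
open import Data.Nat.ListAction using (sum)
open import Data.Bool.ListAction using (any)
open import Data.List.Relation.Unary.Linked using (Linked)
open import Data.List.Relation.Unary.Unique.Propositional using (Unique)
open import Data.List.Relation.Binary.Permutation.Propositional using (_↭_)
open import Data.Product using (Σ; ∃; _×_)
open import Relation.Nullary using (¬_)
open import Relation.Nullary.Decidable using (⌊_⌋)
open import Relation.Binary.PropositionalEquality using (_≡_)

Graph : ℕ → Set
Graph n = Fin n → Fin n → Bool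

module _ {n : ℕ} (G : Graph n) where

  Adj : Fin n → Fin n → Set
  Adj u v = T (G u v)

  Symmetric : Set
  Symmetric = ∀ u v → G u v ≡ G v u

  Irreflexive : Set
  Irreflexive = ∀ u → G u u ≡ false

  data Walk : Fin n → Fin n → Set where
    []  : ∀ {u} → Walk u u
    _∷_ : ∀ {u w v} → Adj u w → Walk w v → Walk u v

  Connected : Set
  Connected = ∀ u v → Walk u v

  HasCycle : Set
  HasCycle = Σ (Fin n) λ v0 → Σ (List (Fin n)) λ xs →
               (2 ≤ length xs) × Unique (v0 ∷ xs) × Linked Adj (v0 ∷ xs ++ v0 ∷ [])

  Acyclic : Set
  Acyclic = ¬ HasCycle

  IsTree : Set
  IsTree = Symmetric × Irreflexive × Connected × Acyclic

  degree : Fin n → ℕ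
  degree u = sum (map (λ v → if G u v then 1 else 0) (allFin n))

  -- degree sequence (as a list; compared up to permutation, i.e. as a multiset)
  degSeq : List ℕ
  degSeq = map degree (allFin n)

  reach : ℕ → Fin n → Fin n → Bool
  reach zero    u v = ⌊ u ≟ v ⌋
  reach (suc k) u v = reach k u v ∨ any (λ w → reach k u w ∧ G w v) (allFin n)

  -- least k in [start, start + fuel) satisfying p (returns start + fuel if none)
  private
    search : (ℕ → Bool) → ℕ → ℕ → ℕ
    search p k zero    = k
    search p k (suc f) = if p k then k else search p (suc k) f

  -- distance: length of a shortest walk (in a connected graph on n vertices it is < n)
  dist : Fin n → Fin n → ℕ
  dist u v = search (λ k → reach k u v) 0 n

  ecc : Fin n → ℕ
  ecc v = foldr _⊔_ 0 (map (λ u → dist u v) (allFin n))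

  Ecc : ℕ
  Ecc = sum (map ecc (allFin n))

  countEccLE : ℕ → ℕ
  countEccLE ℓ = sum (map (λ z → if ecc z ≤ᵇ ℓ then 1 else 0) (allFin n))

TreeDegreeSequence : List ℕ → Set
TreeDegreeSequence ds = Σ (Graph (length ds)) λ T → IsTree T × (degSeq T ↭ ds)

-- Greedy tree. Given ds = d_0 ≥ d_1 ≥ ... ≥ d_{n-1}, vertices are labelled 0..n-1 in
-- breadth-first (level by level, left to right) order, vertex i having degree d_i.
-- Vertex i has down-degree down i (d_0 for the root, d_i - 1 otherwise), and its
-- children are the next block of consecutive not yet connected vertices:
-- start i, ..., start i + down i - 1, where start i = 1 + Σ_{k<i} down k.
nthOr0 : List ℕ → ℕ → ℕ
nthOr0 []       _       = 0
nthOr0 (x ∷ xs) zero    = x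
nthOr0 (x ∷ xs) (suc k) = nthOr0 xs k

down : List ℕ → ℕ → ℕ
down ds zero    = nthOr0 ds 0
down ds (suc i) = nthOr0 ds (suc i) ∸ 1

start : List ℕ → ℕ → ℕ
start ds i = 1 + sum (map (down ds) (upTo i))

isChild : List ℕ → ℕ → ℕ → Bool
isChild ds i j = (start ds i ≤ᵇ j) ∧ (j <ᵇ start ds i + down ds i)

greedy : (ds : List ℕ) → Graph (length ds)
greedy ds u v = isChild ds (toℕ u) (toℕ v) ∨ isChild ds (toℕ v) (toℕ u)

{-# OPTIONS --safe #-}
module Submission where

open import Defs
open import Data.Bool using (Bool; true; false; if_then_else_; T; _∧_; _∨_)
open import Data.Bool.Properties using (T-∧; T-∨; ∨-zeroʳ)
open import Data.Empty using (⊥; ⊥-elim)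
open import Data.Fin using (Fin; zero; suc; toℕ; fromℕ<; _≟_)
open import Data.Fin.Properties using (any?; injective⇒≤; toℕ-injective; toℕ<n; toℕ-fromℕ<)
open import Data.List using (List; []; _∷_; _++_; _∷ʳ_; map; foldr; allFin; upTo; length; take)
open import Data.List.Membership.Propositional using (_∈_; lose; find)
open import Data.List.Membership.Propositional.Properties using (∈-allFin; ∈-∃++)
open import Data.List.Properties using (map-cong; map-++; map-tabulate; upTo-∷ʳ; take-all)
open import Data.List.Relation.Binary.Permutation.Propositional using (_↭_; ↭-reflexive)
open import Data.List.Relation.Binary.Permutation.Propositional.Properties using (↭-map-inv; All-resp-↭; map⁺)
open import Data.List.Relation.Unary.All as All using (All; []; _∷_)
import Data.List.Relation.Unary.All.Properties as All
open import Data.List.Relation.Unary.AllPairs using ([]; _∷_)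
open import Data.List.Relation.Unary.Any using (here; there)
open import Data.List.Relation.Unary.Any.Properties using (any⁺; any⁻)
open import Data.List.Relation.Unary.Linked as Linked using (Linked; []; [-]; _∷_)
open import Data.List.Relation.Unary.Unique.Propositional using (Unique)
open import Data.Nat hiding (_≟_)
open import Data.Nat.ListAction using (sum)
open import Data.Nat.ListAction.Properties using (sum-++; sum-↭)
open import Data.Nat.Properties hiding (_≟_)
open import Data.Nat.Tactic.RingSolver using (solve-∀)
open import Data.Product using (∃; _×_; _,_; proj₁; proj₂)
open import Data.Sum using (_⊎_; inj₁; inj₂; [_,_]′)
open import Function using (Equivalence; _∘_; id)
open import Relation.Nullary using (does; yes; no; ¬_; ¬?; contradiction)
open import Relation.Nullary.Decidable using (_×-dec_; dec-true; fromWitness; toWitness)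
open import Relation.Binary.PropositionalEquality
open import Algebra.Properties.CommutativeSemigroup +-commutativeSemigroup using (interchange)
open Equivalence using (to; from)

-- Root a tree at a vertex c and let par fix c. For a set A containing c,
--   |par⁻¹ A| + |A| = 2 + Σ_{y ∈ A} deg y,
-- hence |par⁻¹ A| ≤ start |A|, where start m = 2 + Σ_{i < m} (d_i − 1) for 1 ≤ m ≤ n.
-- Take c of minimal eccentricity r and let A be the centre, which is {c} or an edge {c , z}.
-- The vertices of eccentricity ≤ r + k lie in (par^k)⁻¹ A, so there are at most start^k |A| of
-- them. All vertices lie within r, respectively r − 1, of A, so n ≤ start^s |A| for that number s.
-- In the greedy tree, par^k maps the first start^k m vertices into the first m ones. As it thus
-- has radius at most s around its first |A| vertices, its first start^k |A| vertices all have
-- eccentricity ≤ r + k. The statement on Ecc follows from Ecc T + Σ_{ℓ < n} countEccLE T ℓ = n².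

-- Finite sums and indicators.

⟦_⟧ : Bool → ℕ
⟦ b ⟧ = if b then 1 else 0

module _ {A : Set} where

  sum-map-+ : (f g : A → ℕ) (xs : List A) →
    sum (map (λ x → f x + g x) xs) ≡ sum (map f xs) + sum (map g xs)
  sum-map-+ f g []       = refl
  sum-map-+ f g (x ∷ xs) =
    trans (cong (f x + g x +_) (sum-map-+ f g xs)) (interchange (f x) (g x) _ _)

  sum-map-mono : {f g : A → ℕ} → (∀ x → f x ≤ g x) → ∀ xs → sum (map f xs) ≤ sum (map g xs)
  sum-map-mono f≤g []       = z≤n
  sum-map-mono f≤g (x ∷ xs) = +-mono-≤ (f≤g x) (sum-map-mono f≤g xs)

  sum-map-cong : {f g : A → ℕ} → (∀ x → f x ≡ g x) → ∀ xs → sum (map f xs) ≡ sum (map g xs)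
  sum-map-cong f≡g xs = cong sum (map-cong f≡g xs)

  sum-map-zero : (xs : List A) → sum (map (λ _ → 0) xs) ≡ 0
  sum-map-zero []       = refl
  sum-map-zero (_ ∷ xs) = sum-map-zero xs

  sum-map-* : (k : ℕ) (f : A → ℕ) (xs : List A) → sum (map (λ x → k * f x) xs) ≡ k * sum (map f xs)
  sum-map-* k f []       = sym (*-zeroʳ k)
  sum-map-* k f (x ∷ xs) =
    trans (cong (k * f x +_) (sum-map-* k f xs)) (sym (*-distribˡ-+ k (f x) _))

sum-map-swap : {A B : Set} (f : A → B → ℕ) (xs : List A) (ys : List B) →
  sum (map (λ x → sum (map (f x) ys)) xs) ≡ sum (map (λ y → sum (map (λ x → f x y) xs)) ys)
sum-map-swap f []       ys = sym (sum-map-zero ys)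
sum-map-swap f (x ∷ xs) ys =
  trans (cong (sum (map (f x) ys) +_) (sum-map-swap f xs ys))
        (sym (sum-map-+ (f x) (λ y → sum (map (λ x → f x y) xs)) ys))

∑ : ∀ {n} → (Fin n → ℕ) → ℕ
∑ {n} f = sum (map f (allFin n))

∑-cong : ∀ {n} {f g : Fin n → ℕ} → (∀ i → f i ≡ g i) → ∑ f ≡ ∑ g
∑-cong {n} f≡g = sum-map-cong f≡g (allFin n)

∑-mono : ∀ {n} {f g : Fin n → ℕ} → (∀ i → f i ≤ g i) → ∑ f ≤ ∑ g
∑-mono {n} f≤g = sum-map-mono f≤g (allFin n)

∑-+ : ∀ {n} (f g : Fin n → ℕ) → ∑ (λ i → f i + g i) ≡ ∑ f + ∑ g
∑-+ {n} f g = sum-map-+ f g (allFin n)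

∑-* : ∀ {n} k (f : Fin n → ℕ) → ∑ (λ i → k * f i) ≡ k * ∑ f
∑-* {n} k f = sum-map-* k f (allFin n)

∑-swap : ∀ {m n} (f : Fin m → Fin n → ℕ) →
  ∑ (λ i → ∑ (λ j → f i j)) ≡ ∑ (λ j → ∑ (λ i → f i j))
∑-swap {m} {n} f = sum-map-swap f (allFin m) (allFin n)

map-allFin-suc : ∀ {A : Set} {n} (f : Fin (suc n) → A) →
  map f (allFin (suc n)) ≡ f zero ∷ map (f ∘ suc) (allFin n)
map-allFin-suc f =
  cong (f zero ∷_) (trans (map-tabulate suc f) (sym (map-tabulate id (f ∘ suc))))

∑-suc : ∀ {n} (f : Fin (suc n) → ℕ) → ∑ f ≡ f zero + ∑ (f ∘ suc)
∑-suc f = cong sum (map-allFin-suc f)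

∑-zero : ∀ n → ∑ {n} (λ _ → 0) ≡ 0
∑-zero n = sum-map-zero (allFin n)

∑-const : ∀ n k → ∑ {n} (λ _ → k) ≡ n * k
∑-const zero    k = refl
∑-const (suc n) k = trans (∑-suc {n} (λ _ → k)) (cong (k +_) (∑-const n k))

∑-one : ∀ n → ∑ {n} (λ _ → 1) ≡ n
∑-one n = trans (∑-const n 1) (*-identityʳ n)

∑-point : ∀ {n} (a : Fin n) → ∑ (λ i → ⟦ does (a ≟ i) ⟧) ≡ 1
∑-point {suc n} zero    = trans (∑-suc {n} (λ i → ⟦ does (zero ≟ i) ⟧)) (cong suc (∑-zero n))
∑-point {suc n} (suc a) = trans (∑-suc {n} (λ i → ⟦ does (suc a ≟ i) ⟧)) (∑-point a)

∑-< : ∀ {n b} → b ≤ n → ∑ {n} (λ i → ⟦ toℕ i <ᵇ b ⟧) ≡ b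
∑-< {n} {zero}  z≤n       = ∑-zero n
∑-< {suc n} {suc b} (s≤s b≤n) = trans (∑-suc {n} (λ i → ⟦ toℕ i <ᵇ suc b ⟧)) (cong suc (∑-< b≤n))

-- Distance and eccentricity in terms of walks.

-- The search underlying `dist` is private in Defs: the unnamed body of `leastFrom` is
-- found by unification, once `with` has turned all arguments of that search into variables.
mutual
  leastFrom : ∀ {n} → Graph n → (ℕ → Bool) → ℕ → ℕ → ℕ
  leastFrom G p k f = _

  dist-unfold : ∀ {m} (G : Graph (suc m)) u v →
    dist G u v ≡ (if reach G 0 u v then 0 else leastFrom G (λ k → reach G k u v) 1 m)
  dist-unfold {m} G u v with suc m | G | u | v | (λ k → reach G k u v) | 1
  ... | _ | _ | _ | _ | _ | _ = refl

module _ {n} (G : Graph n) (p : ℕ → Bool) where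

  leastFrom-≤ : ∀ k f {j} → k ≤ j → T (p j) → leastFrom G p k f ≤ j
  leastFrom-≤ k zero    k≤j pj = k≤j
  leastFrom-≤ k (suc f) k≤j pj with p k in eq
  ... | true  = k≤j
  ... | false = leastFrom-≤ (suc k) f (≤∧≢⇒< k≤j λ { refl → subst T eq pj }) pj

  leastFrom-bound : ∀ k f → leastFrom G p k f ≤ k + f
  leastFrom-bound k zero    = m≤m+n k 0
  leastFrom-bound k (suc f) with p k
  ... | true  = m≤m+n k (suc f)
  ... | false = ≤-trans (leastFrom-bound (suc k) f) (≤-reflexive (sym (+-suc k f)))

  -- A failed search also returns `k + f`, so only a result strictly below that certifies `p`.
  leastFrom-hit : ∀ k f → leastFrom G p k f < k + f → T (p (leastFrom G p k f))
  leastFrom-hit k zero    lt = ⊥-elim (<-irrefl (sym (+-identityʳ k)) lt)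
  leastFrom-hit k (suc f) lt with p k in eq
  ... | true  = subst T (sym eq) _
  ... | false = leastFrom-hit (suc k) f (<-≤-trans lt (≤-reflexive (+-suc k f)))

module _ {n} (G : Graph n) where

  -- Walks of bounded length, with the new edge at the far end to follow the recursion of `reach`.
  data Within : ℕ → Fin n → Fin n → Set where
    stay : ∀ {k u} → Within k u u
    _▷_  : ∀ {k u w v} → Within k u w → Adj G w v → Within (suc k) u v

module _ {n} {G : Graph n} where

  Within-mono : ∀ {k l u v} → k ≤ l → Within G k u v → Within G l u v
  Within-mono k≤l       stay    = stay
  Within-mono (s≤s k≤l) (p ▷ a) = Within-mono k≤l p ▷ a

  Within-trans : ∀ {k l u v w} → Within G k u v → Within G l v w → Within G (k + l) u w
  Within-trans {k} {l} p stay = Within-mono (m≤m+n k l) p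
  Within-trans {k} {suc l} {u} {w = w} p (q ▷ a) =
    subst (λ m → Within G m u w) (sym (+-suc k l)) (Within-trans p q ▷ a)

  Within-sym : Symmetric G → ∀ {k u v} → Within G k u v → Within G k v u
  Within-sym s stay                        = stay
  Within-sym s (_▷_ {w = w} {v = v} p a) = Within-trans (stay ▷ subst T (s w v) a) (Within-sym s p)

  reach-suc : ∀ {k u v} → T (reach G k u v) → T (reach G (suc k) u v)
  reach-suc r = from T-∨ (inj₁ r)

  Within⇒reach : ∀ {k u v} → Within G k u v → T (reach G k u v)
  Within⇒reach {zero}  {u} stay = fromWitness {a? = u ≟ u} refl
  Within⇒reach {suc k} {u} stay = reach-suc {k} {u} {u} (Within⇒reach {k} {u} stay)
  Within⇒reach {suc k} {u} {v} (_▷_ {w = w} p a) =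
    from (T-∨ {reach G k u v})
      (inj₂ (any⁺ (λ w → reach G k u w ∧ G w v)
        (lose (∈-allFin w) (from T-∧ (Within⇒reach p , a)))))

  reach⇒Within : ∀ {k u v} → T (reach G k u v) → Within G k u v
  reach⇒Within {zero}  {u} {v} r with refl ← toWitness {a? = u ≟ v} r = stay
  reach⇒Within {suc k} {u} {v} r with to (T-∨ {reach G k u v}) r
  ... | inj₁ r′ = Within-mono (n≤1+n k) (reach⇒Within r′)
  ... | inj₂ s with find (any⁻ (λ w → reach G k u w ∧ G w v) (allFin n) s)
  ...   | w , _ , rw with to (T-∧ {reach G k u w}) rw
  ...     | r′ , a = reach⇒Within r′ ▷ a

  Within⇒dist≤ : ∀ {k u v} → Within G k u v → dist G u v ≤ k
  Within⇒dist≤ {u = u} {v} p = leastFrom-≤ G (λ k → reach G k u v) 0 n z≤n (Within⇒reach p)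

  dist≤n : ∀ u v → dist G u v ≤ n
  dist≤n u v = leastFrom-bound G (λ k → reach G k u v) 0 n

  dist<n⇒Within : ∀ {u v} → dist G u v < n → Within G (dist G u v) u v
  dist<n⇒Within {u} {v} lt = reach⇒Within (leastFrom-hit G (λ k → reach G k u v) 0 n lt)

module _ {A : Set} (f : A → ℕ) where

  max-map-≤ : ∀ xs {b} → (∀ x → f x ≤ b) → foldr _⊔_ 0 (map f xs) ≤ b
  max-map-≤ []       f≤b = z≤n
  max-map-≤ (x ∷ xs) f≤b = ⊔-lub (f≤b x) (max-map-≤ xs f≤b)

  ≤-max-map : ∀ {x xs} → x ∈ xs → f x ≤ foldr _⊔_ 0 (map f xs)
  ≤-max-map (here refl) = m≤m⊔n _ _
  ≤-max-map (there x∈)  = ≤-trans (≤-max-map x∈) (m≤n⊔m _ _)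

module _ {n} {G : Graph n} where

  ecc-≤ : ∀ {v b} → (∀ u → dist G u v ≤ b) → ecc G v ≤ b
  ecc-≤ {v} h = max-map-≤ (λ u → dist G u v) (allFin n) h

  dist≤ecc : ∀ u v → dist G u v ≤ ecc G v
  dist≤ecc u v = ≤-max-map (λ u → dist G u v) (∈-allFin u)

  ecc≤n : ∀ v → ecc G v ≤ n
  ecc≤n v = ecc-≤ λ u → dist≤n {G = G} u v

-- Rooted trees and degree counting.

record Rooted {n} (G : Graph n) (c : Fin n) : Set where
  field
    par      : Fin n → Fin n
    rank     : Fin n → ℕ
    par-root : par c ≡ c
    rank-par : ∀ {v} → v ≢ c → rank (par v) < rank v
    par-adj  : ∀ {v} → v ≢ c → Adj G (par v) v
    adj-par  : ∀ {v} → v ≢ c → Adj G v (par v)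
    adj-inv  : ∀ {u v} → Adj G u v → (v ≢ c × u ≡ par v) ⊎ (u ≢ c × v ≡ par u)

∑-select : ∀ {n} (g : Fin n → ℕ) (a : Fin n) → ∑ (λ y → g y * ⟦ does (a ≟ y) ⟧) ≡ g a
∑-select g a = begin
  ∑ (λ y → g y * ⟦ does (a ≟ y) ⟧)  ≡⟨ ∑-cong pointwise ⟩
  ∑ (λ y → g a * ⟦ does (a ≟ y) ⟧)  ≡⟨ ∑-* (g a) (λ y → ⟦ does (a ≟ y) ⟧) ⟩
  g a * ∑ (λ y → ⟦ does (a ≟ y) ⟧)  ≡⟨ cong (g a *_) (∑-point a) ⟩
  g a * 1                            ≡⟨ *-identityʳ (g a) ⟩
  g a                                ∎
  where
  open ≡-Reasoning
  pointwise : ∀ y → g y * ⟦ does (a ≟ y) ⟧ ≡ g a * ⟦ does (a ≟ y) ⟧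
  pointwise y with a ≟ y
  ... | yes refl = refl
  ... | no _     = trans (*-zeroʳ (g y)) (sym (*-zeroʳ (g a)))

module _ {n} {G : Graph n} {c : Fin n} (R : Rooted G c) where
  open Rooted R

  fibre : Fin n → ℕ
  fibre y = ∑ (λ v → ⟦ does (par v ≟ y) ⟧)

  private
    -- A neighbour of y is either a child or the parent. The two products correct for y = c, which
    -- has no parent but is its own image under `par`.
    adjacency-split : ∀ y v →
      ⟦ G y v ⟧ + (⟦ does (c ≟ y) ⟧ * ⟦ does (c ≟ v) ⟧ + ⟦ does (c ≟ y) ⟧ * ⟦ does (par y ≟ v) ⟧)
        ≡ ⟦ does (par v ≟ y) ⟧ + ⟦ does (par y ≟ v) ⟧
    adjacency-split y v with c ≟ y
    adjacency-split y v | yes refl rewrite par-root with c ≟ v | par v ≟ c | G c v in eq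
    ... | yes refl | yes _ | false = refl
    ... | yes refl | yes _ | true =
      ⊥-elim ([ (λ p → proj₁ p refl) , (λ p → proj₁ p refl) ]′ (adj-inv (subst T (sym eq) _)))
    ... | yes refl | no ¬p | _ = contradiction par-root ¬p
    ... | no c≢v | yes p | true = refl
    ... | no c≢v | yes p | false =
      ⊥-elim (subst T eq (subst (λ a → Adj G a v) p (par-adj λ v≡c → c≢v (sym v≡c))))
    ... | no c≢v | no ¬p | false = refl
    ... | no c≢v | no ¬p | true with adj-inv {c} {v} (subst T (sym eq) _)
    ...   | inj₁ (_ , c≡p) = contradiction (sym c≡p) ¬p
    ...   | inj₂ (c≢c , _) = contradiction refl c≢c
    adjacency-split y v | no c≢y with par v ≟ y | par y ≟ v | G y v in eq
    -- Here y and v are each other's parents, so the rank would fall in both directions.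
    ... | yes refl | yes p | _ = ⊥-elim (<-asym (rank-par v≢c)
      (subst (λ a → rank a < rank (par v)) p (rank-par λ p≡c → c≢y (sym p≡c))))
      where v≢c : v ≢ c
            v≢c refl = c≢y (sym par-root)
    ... | yes refl | no _ | true = refl
    ... | yes refl | no _ | false = ⊥-elim (subst T eq (par-adj λ { refl → c≢y (sym par-root) }))
    ... | no _ | yes refl | true = refl
    ... | no _ | yes refl | false = ⊥-elim (subst T eq (adj-par λ y≡c → c≢y (sym y≡c)))
    ... | no _ | no _ | false = refl
    ... | no ¬p | no ¬q | true with adj-inv {y} {v} (subst T (sym eq) _)
    ...   | inj₁ (_ , p) = contradiction (sym p) ¬p
    ...   | inj₂ (_ , q) = contradiction (sym q) ¬q

  -- Neighbours are the children and the parent. The root lacks a parent and lies in its own fibre,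
  -- hence the 2.
  degree-fibre : ∀ y → degree G y + 2 * ⟦ does (c ≟ y) ⟧ ≡ fibre y + 1
  degree-fibre y = begin
    degree G y + 2 * e
      ≡⟨ cong (degree G y +_) (double e) ⟩
    degree G y + (e * 1 + e * 1)
      ≡⟨ cong (degree G y +_) (cong₂ (λ a b → e * a + e * b) (∑-point c) (∑-point (par y))) ⟨
    degree G y + (e * ∑ (λ v → ⟦ does (c ≟ v) ⟧) + e * ∑ (λ v → ⟦ does (par y ≟ v) ⟧))
      ≡⟨ cong (degree G y +_) (cong₂ _+_ (∑-* e (λ v → ⟦ does (c ≟ v) ⟧)) (∑-* e (λ v → ⟦ does (par y ≟ v) ⟧))) ⟨
    degree G y + (∑ (λ v → e * ⟦ does (c ≟ v) ⟧) + ∑ (λ v → e * ⟦ does (par y ≟ v) ⟧))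
      ≡⟨ cong (degree G y +_) (∑-+ (λ v → e * ⟦ does (c ≟ v) ⟧) (λ v → e * ⟦ does (par y ≟ v) ⟧)) ⟨
    degree G y + ∑ (λ v → e * ⟦ does (c ≟ v) ⟧ + e * ⟦ does (par y ≟ v) ⟧)
      ≡⟨ ∑-+ (λ v → ⟦ G y v ⟧) (λ v → e * ⟦ does (c ≟ v) ⟧ + e * ⟦ does (par y ≟ v) ⟧) ⟨
    ∑ (λ v → ⟦ G y v ⟧ + (e * ⟦ does (c ≟ v) ⟧ + e * ⟦ does (par y ≟ v) ⟧))
      ≡⟨ ∑-cong (adjacency-split y) ⟩
    ∑ (λ v → ⟦ does (par v ≟ y) ⟧ + ⟦ does (par y ≟ v) ⟧)
      ≡⟨ ∑-+ (λ v → ⟦ does (par v ≟ y) ⟧) (λ v → ⟦ does (par y ≟ v) ⟧) ⟩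
    fibre y + ∑ (λ v → ⟦ does (par y ≟ v) ⟧)
      ≡⟨ cong (fibre y +_) (∑-point (par y)) ⟩
    fibre y + 1 ∎
    where
    open ≡-Reasoning
    e = ⟦ does (c ≟ y) ⟧
    double : ∀ e → 2 * e ≡ e * 1 + e * 1
    double = solve-∀

  -- As par c = c, the preimage under par of a connected set containing c is its closed
  -- neighbourhood.
  neighbourhood-count : (A : Fin n → Bool) → A c ≡ true →
    ∑ (λ x → ⟦ A (par x) ⟧) + ∑ (λ y → ⟦ A y ⟧) ≡ ∑ (λ y → ⟦ A y ⟧ * degree G y) + 2
  neighbourhood-count A Ac = begin
    ∑ (λ x → ⟦ A (par x) ⟧) + ∑ (λ y → ⟦ A y ⟧)
      ≡⟨ cong (_+ ∑ (λ y → ⟦ A y ⟧)) (∑-cong λ x → sym (∑-select (λ y → ⟦ A y ⟧) (par x))) ⟩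
    ∑ (λ x → ∑ (λ y → ⟦ A y ⟧ * ⟦ does (par x ≟ y) ⟧)) + ∑ (λ y → ⟦ A y ⟧)
      ≡⟨ cong (_+ ∑ (λ y → ⟦ A y ⟧)) (∑-swap (λ x y → ⟦ A y ⟧ * ⟦ does (par x ≟ y) ⟧)) ⟩
    ∑ (λ y → ∑ (λ x → ⟦ A y ⟧ * ⟦ does (par x ≟ y) ⟧)) + ∑ (λ y → ⟦ A y ⟧)
      ≡⟨ cong (_+ ∑ (λ y → ⟦ A y ⟧)) (∑-cong λ y → ∑-* ⟦ A y ⟧ (λ x → ⟦ does (par x ≟ y) ⟧)) ⟩
    ∑ (λ y → ⟦ A y ⟧ * fibre y) + ∑ (λ y → ⟦ A y ⟧)
      ≡⟨ ∑-+ (λ y → ⟦ A y ⟧ * fibre y) (λ y → ⟦ A y ⟧) ⟨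
    ∑ (λ y → ⟦ A y ⟧ * fibre y + ⟦ A y ⟧)
      ≡⟨ ∑-cong pointwise ⟩
    ∑ (λ y → ⟦ A y ⟧ * degree G y + 2 * (⟦ A y ⟧ * ⟦ does (c ≟ y) ⟧))
      ≡⟨ ∑-+ (λ y → ⟦ A y ⟧ * degree G y) (λ y → 2 * (⟦ A y ⟧ * ⟦ does (c ≟ y) ⟧)) ⟩
    D + ∑ (λ y → 2 * (⟦ A y ⟧ * ⟦ does (c ≟ y) ⟧))
      ≡⟨ cong (D +_) (∑-* 2 (λ y → ⟦ A y ⟧ * ⟦ does (c ≟ y) ⟧)) ⟩
    D + 2 * ∑ (λ y → ⟦ A y ⟧ * ⟦ does (c ≟ y) ⟧)
      ≡⟨ cong (λ a → D + 2 * a) (trans (∑-select (λ y → ⟦ A y ⟧) c) (cong ⟦_⟧ Ac)) ⟩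
    D + 2 ∎
    where
    open ≡-Reasoning
    D = ∑ (λ y → ⟦ A y ⟧ * degree G y)
    factor : ∀ a f → a * f + a ≡ a * (f + 1)
    factor = solve-∀
    expand : ∀ a d e → a * (d + 2 * e) ≡ a * d + 2 * (a * e)
    expand = solve-∀
    pointwise : ∀ y → ⟦ A y ⟧ * fibre y + ⟦ A y ⟧ ≡ ⟦ A y ⟧ * degree G y + 2 * (⟦ A y ⟧ * ⟦ does (c ≟ y) ⟧)
    pointwise y = trans (factor ⟦ A y ⟧ (fibre y))
      (trans (cong (⟦ A y ⟧ *_) (sym (degree-fibre y))) (expand ⟦ A y ⟧ (degree G y) _))

  -- A graph with a parent map is a tree.

  adj-sym : ∀ {u v} → Adj G u v → Adj G v u
  adj-sym a with adj-inv a
  ... | inj₁ (v≢c , refl) = adj-par v≢c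
  ... | inj₂ (u≢c , refl) = par-adj u≢c

  Rooted⇒Symmetric : Symmetric G
  Rooted⇒Symmetric u v with G u v in p | G v u in q
  ... | true  | true  = refl
  ... | false | false = refl
  ... | true  | false = ⊥-elim (subst T q (adj-sym {u} {v} (subst T (sym p) _)))
  ... | false | true  = ⊥-elim (subst T p (adj-sym {v} {u} (subst T (sym q) _)))

  Rooted⇒Irreflexive : Irreflexive G
  Rooted⇒Irreflexive u with G u u in eq
  ... | false = refl
  ... | true with adj-inv {u} {u} (subst T (sym eq) _)
  ...   | inj₁ (u≢c , p) = ⊥-elim (<-irrefl (cong rank (sym p)) (rank-par u≢c))
  ...   | inj₂ (u≢c , p) = ⊥-elim (<-irrefl (cong rank (sym p)) (rank-par u≢c))

  private
    _++ʷ_ : ∀ {u v w} → Walk G u v → Walk G v w → Walk G u w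
    []      ++ʷ q = q
    (a ∷ p) ++ʷ q = a ∷ (p ++ʷ q)

    connect : ∀ k v → rank v < k → Walk G c v × Walk G v c
    connect (suc k) v lt with v ≟ c
    ... | yes refl = [] , []
    ... | no v≢c with connect k (par v) (<-≤-trans (rank-par v≢c) (s≤s⁻¹ lt))
    ...   | p , q = p ++ʷ (par-adj v≢c ∷ []) , adj-par v≢c ∷ q

    -- Non-backtracking walks: first, second, last but one and last vertex.
    data Trail : (a b p e : Fin n) → Set where
      one  : ∀ {a b} → Adj G a b → Trail a b a b
      cons : ∀ {a b d p e} → Adj G a b → a ≢ d → Trail b d p e → Trail a b p e

    Trail-adj : ∀ {a b p e} → Trail a b p e → Adj G a b
    Trail-adj (one x)      = x
    Trail-adj (cons x _ _) = x

    -- A non-backtracking walk that has once left a vertex for a child keeps descending.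
    descend : ∀ {a b p e} → Trail a b p e → b ≢ c → a ≡ par b → rank a < rank e
    descend (one _) b≢c refl = rank-par b≢c
    descend (cons _ a≢d t) b≢c refl with adj-inv (Trail-adj t)
    ... | inj₁ (d≢c , b≡) = <-trans (rank-par b≢c) (descend t d≢c b≡)
    ... | inj₂ (_ , d≡)   = contradiction (sym d≡) a≢d

    -- After a downward step, going up again would be backtracking. So the walk goes up first and
    -- then down: either its last step is downward, or it only climbs and the rank falls.
    ascend : ∀ {a b p e} → Trail a b p e → (e ≢ c × p ≡ par e) ⊎ rank e < rank a
    ascend (one x) with adj-inv x
    ... | inj₁ p            = inj₁ p
    ... | inj₂ (a≢c , refl) = inj₂ (rank-par a≢c)
    ascend (cons x a≢d t) with ascend t
    ... | inj₁ p = inj₁ p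
    ... | inj₂ lt with adj-inv x
    ...   | inj₂ (a≢c , refl) = inj₂ (<-trans lt (rank-par a≢c))
    ...   | inj₁ (b≢c , refl) with adj-inv (Trail-adj t)
    ...     | inj₁ (d≢c , b≡) = ⊥-elim (<-asym lt (descend t d≢c b≡))
    ...     | inj₂ (_ , d≡)   = contradiction (sym d≡) a≢d

    -- Uniqueness rules out backtracking inside the list; at the closing step e is off the list. The
    -- position of p is kept for `Rooted⇒Acyclic`.
    trail : ∀ {a b r e} → Unique (a ∷ b ∷ r) → All (e ≢_) (a ∷ b ∷ r) →
      Linked (Adj G) (a ∷ b ∷ r ++ e ∷ []) → ∃ λ p → Trail a b p e × p ∈ b ∷ r
    trail {b = b} {r = []} _ (e≢a ∷ _) (x ∷ y ∷ [-]) =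
      b , cons x (λ a≡e → e≢a (sym a≡e)) (one y) , here refl
    trail {r = _ ∷ _} ((_ ∷ a≢d ∷ _) ∷ un) (_ ∷ e≢) (x ∷ l) with trail un e≢ l
    ... | p , t , p∈ = p , cons x a≢d t , there p∈

  -- Let x follow v on a cycle. If x is a child of v, the walk descends throughout and returns to v
  -- with larger rank. If x is the parent of v, the walk either only climbs, returning with smaller
  -- rank, or comes back down from the parent x, which then occurs twice.
  Rooted⇒Acyclic : Acyclic G
  Rooted⇒Acyclic (v , [] , () , _)
  Rooted⇒Acyclic (v , _ ∷ [] , s≤s () , _)
  Rooted⇒Acyclic (v , x ∷ y ∷ r , _ , (v≢@(_ ∷ v≢y ∷ _) ∷ un@(x≢ ∷ _)) , (a ∷ l))
    with trail un v≢ l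
  ... | p , t , p∈ with adj-inv a
  ...   | inj₁ (x≢c , v≡) = <-irrefl refl (descend (cons a v≢y t) x≢c v≡)
  ...   | inj₂ (v≢c , refl) with ascend (cons a v≢y t)
  ...     | inj₁ (_ , p≡) = All.lookup x≢ p∈ (sym p≡)
  ...     | inj₂ lt       = <-irrefl refl lt

  Rooted⇒IsTree : IsTree G
  Rooted⇒IsTree = Rooted⇒Symmetric , Rooted⇒Irreflexive , connected , Rooted⇒Acyclic
    where
    connected : Connected G
    connected u v = proj₂ (connect (suc (rank u)) u ≤-refl) ++ʷ proj₁ (connect (suc (rank v)) v ≤-refl)

-- Rooting a tree by distance from a vertex.

least : (p : ℕ → Bool) (m : ℕ) → T (p m) → ∃ λ k → T (p k) × (∀ j → T (p j) → k ≤ j)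
least p zero    pm = 0 , pm , λ _ _ → z≤n
least p (suc m) pm with p 0 in eq
... | true  = 0 , subst T (sym eq) _ , λ _ _ → z≤n
... | false with least (p ∘ suc) m pm
...   | k , pk , k≤ = suc k , pk , λ where
          zero    p0 → ⊥-elim (subst T eq p0)
          (suc j) pj → s≤s (k≤ j pj)

record DistanceRooted {n} (G : Graph n) (c : Fin n) : Set where
  field
    rooted : Rooted G c
  open Rooted rooted public
  field
    rank-root  : rank c ≡ 0
    rank-suc   : ∀ {v} → v ≢ c → rank v ≡ suc (rank (par v))
    rank-least : ∀ {k v} → Within G k c v → rank v ≤ k

module _ {A : Set} {_~_ : A → A → Set} where

  Linked-prefix : ∀ {x} as {w bs} → Linked _~_ (x ∷ as ++ w ∷ bs) → Linked _~_ (x ∷ as ++ w ∷ [])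
  Linked-prefix []       (a ∷ _) = a ∷ [-]
  Linked-prefix (_ ∷ as) (a ∷ l) = a ∷ Linked-prefix as l

Unique-prefix : ∀ {A : Set} (as : List A) {w bs} → Unique (as ++ w ∷ bs) → Unique as × All (w ≢_) as
Unique-prefix []       un        = [] , []
Unique-prefix (a ∷ as) (a≢ ∷ un) with Unique-prefix as un | All.++⁻ as a≢
... | un′ , w≢ | a≢as , (a≢w ∷ _) = a≢as ∷ un′ , (λ w≡a → a≢w (sym w≡a)) ∷ w≢

module _ {n} {G : Graph n} (tree : IsTree G) where

  private
    symmetric   = proj₁ tree
    irreflexive = proj₁ (proj₂ tree)
    connected   = proj₁ (proj₂ (proj₂ tree))
    acyclic     = proj₂ (proj₂ (proj₂ tree))

  -- If w recurred beyond y, the stretch of the path before it would close to a cycle through the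
  -- edge from w to x; w = x would be a loop.
  extend-path : ∀ {w x y r} → Unique (x ∷ y ∷ r) → Linked (Adj G) (x ∷ y ∷ r) →
    Adj G w x → w ≢ y → Unique (w ∷ x ∷ y ∷ r)
  extend-path {w} {x} {y} {r} un l a w≢y = All.¬Any⇒All¬ _ w∉ ∷ un
    where
    w∉ : ¬ w ∈ x ∷ y ∷ r
    w∉ (here refl)         = subst T (irreflexive w) a
    w∉ (there (here refl)) = w≢y refl
    w∉ (there (there w∈r)) with ∈-∃++ w∈r
    ... | as , bs , refl with Unique-prefix (x ∷ y ∷ as) un
    ...   | un′ , w≢ = acyclic
      (w , x ∷ y ∷ as , s≤s (s≤s z≤n) , w≢ ∷ un′ , a ∷ Linked-prefix (y ∷ as) l)

  module _ (c : Fin n) where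

    private
      Walk⇒Within : ∀ {u v} → Walk G u v → ∃ λ k → Within G k u v
      Walk⇒Within []      = 0 , stay
      Walk⇒Within (a ∷ p) with Walk⇒Within p
      ... | k , q = suc k , Within-trans (stay ▷ a) q

      depth : ∀ v → ∃ λ k → Within G k c v × (∀ {j} → Within G j c v → k ≤ j)
      depth v with Walk⇒Within (connected c v)
      ... | m , q with least (λ k → reach G k c v) m (Within⇒reach q)
      ...   | k , r , k≤ = k , reach⇒Within r , λ q → k≤ _ (Within⇒reach q)

      δ : Fin n → ℕ
      δ v = proj₁ (depth v)

      last-step : ∀ {k v} → Within G k c v → v ≢ c →
        ∃ λ k′ → ∃ λ w → k ≡ suc k′ × Within G k′ c w × Adj G w v
      last-step stay    v≢c = contradiction refl v≢c
      last-step (q ▷ a) v≢c = _ , _ , refl , q , a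

      -- The vertex before v on a shortest walk from c. Minimality of both depths makes them differ
      -- by exactly one.
      parent : ∀ v → v ≢ c → ∃ λ w → Adj G w v × δ v ≡ suc (δ w)
      parent v v≢c with last-step (proj₁ (proj₂ (depth v))) v≢c
      ... | k , w , δv≡ , q , a = w , a , ≤-antisym
        (proj₂ (proj₂ (depth v)) (proj₁ (proj₂ (depth w)) ▷ a))
        (subst (suc (δ w) ≤_) (sym δv≡) (s≤s (proj₂ (proj₂ (depth w)) q)))

      abstract
        par : Fin n → Fin n
        par v with v ≟ c
        ... | yes _  = c
        ... | no v≢c = proj₁ (parent v v≢c)

        par-root : par c ≡ c
        par-root with c ≟ c
        ... | yes _  = refl
        ... | no c≢c = contradiction refl c≢c

        par-adj : ∀ {v} → v ≢ c → Adj G (par v) v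
        par-adj {v} v≢c with v ≟ c
        ... | yes v≡c = contradiction v≡c v≢c
        ... | no  v≢c′ = proj₁ (proj₂ (parent v v≢c′))

        δ-suc : ∀ {v} → v ≢ c → δ v ≡ suc (δ (par v))
        δ-suc {v} v≢c with v ≟ c
        ... | yes v≡c = contradiction v≡c v≢c
        ... | no  v≢c′ = proj₂ (proj₂ (parent v v≢c′))

      flip-adj : ∀ {u v} → Adj G u v → Adj G v u
      flip-adj {u} {v} = subst T (symmetric u v)

      par≢ : ∀ {v} → v ≢ c → par v ≢ c → v ≢ par (par v)
      par≢ {v} v≢c p≢c eq = <⇒≢ (≤-trans (≤-reflexive (sym (δ-suc p≢c))) (n≤1+n _))
        (trans (cong δ (sym eq)) (δ-suc v≢c))

      -- The path of successive parents from v to c; depths fall along it, so no vertex repeats. The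
      -- final alternative exposes its second vertex, as `extend-path` requires.
      chain : ∀ k v → δ v ≡ k → ∃ λ r → Unique (v ∷ r) × Linked (Adj G) (v ∷ r) × c ∈ v ∷ r ×
        All (λ w → δ w < δ v) r × ((v ≡ c × r ≡ []) ⊎ (∃ λ r′ → r ≡ par v ∷ r′))
      chain k v eq with v ≟ c
      ... | yes refl = [] , [] ∷ [] , [-] , here refl , [] , inj₁ (refl , refl)
      chain zero v eq | no v≢c = contradiction (trans (sym eq) (δ-suc v≢c)) λ ()
      chain (suc k) v eq | no v≢c with chain k (par v) (suc-injective (trans (sym (δ-suc v≢c)) eq))
      ... | r , un , l , c∈ , lt , _ =
        par v ∷ r , All.map (λ { δw<δv refl → <-irrefl refl δw<δv }) below ∷ un ,
        flip-adj (par-adj v≢c) ∷ l , there c∈ , below , inj₂ (r , refl)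
        where
        below : All (λ w → δ w < δ v) (par v ∷ r)
        below = ≤-reflexive (sym (δ-suc v≢c)) ∷
          All.map (λ δw<δp → <-trans δw<δp (≤-reflexive (sym (δ-suc v≢c)))) lt

      -- Prolonging a path by parents until it reaches c, which it already contains.
      climb : ∀ k {x y r} → δ x ≡ k → Unique (x ∷ y ∷ r) → Linked (Adj G) (x ∷ y ∷ r) →
        c ∈ y ∷ r → (x ≢ c → par x ≢ y) → ⊥
      climb k {x} eq un@(x≢ ∷ _) l c∈ fresh with x ≟ c
      ... | yes refl = All.lookup x≢ c∈ refl
      climb zero    eq un l c∈ fresh | no x≢c = contradiction (trans (sym eq) (δ-suc x≢c)) λ ()
      climb (suc k) eq un l c∈ fresh | no x≢c =
        climb k (suc-injective (trans (sym (δ-suc x≢c)) eq))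
          (extend-path un l (par-adj x≢c) (fresh x≢c)) (par-adj x≢c ∷ l) (there c∈)
          (λ p≢c eq′ → par≢ x≢c p≢c (sym eq′))

      -- If an edge joined neither end to its parent, prefixing u to the parent path of v would give
      -- a path that contains c, and `climb` would lead from u to c a second time.
      adj-inv : ∀ {u v} → Adj G u v → (v ≢ c × u ≡ par v) ⊎ (u ≢ c × v ≡ par u)
      adj-inv {u} {v} a with u ≟ par v | v ≟ par u | v ≟ c | u ≟ c
      ... | yes p | _ | no v≢c | _ = inj₁ (v≢c , p)
      ... | _ | yes q | _ | no u≢c = inj₂ (u≢c , q)
      ... | _ | _ | yes refl | yes refl = ⊥-elim (subst T (irreflexive c) a)
      ... | yes p | no _ | yes refl | no u≢c = contradiction (trans p par-root) u≢c
      ... | no _ | yes q | no v≢c | yes refl = contradiction (trans q par-root) v≢c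
      ... | no _ | no q | yes refl | no u≢c =
        ⊥-elim (climb _ refl ((u≢c ∷ []) ∷ [] ∷ []) (a ∷ [-]) (here refl) (λ _ eq → q (sym eq)))
      ... | no p | no q | no v≢c | _ with chain _ v refl
      ...   | _ , _ , _ , _ , _ , inj₁ (v≡c , _) = contradiction v≡c v≢c
      ...   | _ , un , l , c∈ , _ , inj₂ (_ , refl) =
        ⊥-elim (climb _ refl (extend-path un l a p) (a ∷ l) c∈ (λ _ eq → q (sym eq)))

    distanceRooted : DistanceRooted G c
    distanceRooted = record
      { rooted = record
        { par = par ; rank = δ ; par-root = par-root
        ; rank-par = λ v≢c → ≤-reflexive (sym (δ-suc v≢c))
        ; par-adj = par-adj ; adj-par = λ v≢c → flip-adj (par-adj v≢c)
        ; adj-inv = adj-inv }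
      ; rank-root = n≤0⇒n≡0 (proj₂ (proj₂ (depth c)) stay)
      ; rank-suc = δ-suc
      ; rank-least = λ {k} {v} q → proj₂ (proj₂ (depth v)) q }

-- Iterated parents.

infixl 8 _^[_]
_^[_] : ∀ {A : Set} → (A → A) → ℕ → A → A
(f ^[ zero  ]) x = x
(f ^[ suc k ]) x = (f ^[ k ]) (f x)

module _ {n} {G : Graph n} {c : Fin n} (R : Rooted G c) where
  open Rooted R

  iterate-root : ∀ k → (par ^[ k ]) c ≡ c
  iterate-root zero    = refl
  iterate-root (suc k) = trans (cong (par ^[ k ]) par-root) (iterate-root k)

  Within-iterate : ∀ k x → Within G k ((par ^[ k ]) x) x
  Within-iterate zero    x = stay
  Within-iterate (suc k) x with x ≟ c
  ... | yes refl = subst (λ a → Within G (suc k) a x) (sym (iterate-root (suc k))) stay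
  ... | no x≢c   = Within-iterate k (par x) ▷ par-adj x≢c

module _ {n} {G : Graph n} {c : Fin n} (R : DistanceRooted G c) where
  open DistanceRooted R

  rank-iterate : ∀ h x → (par ^[ h ]) x ≢ c → rank x ≡ h + rank ((par ^[ h ]) x)
  rank-iterate zero    x ne = refl
  rank-iterate (suc h) x ne = trans (rank-suc x≢c) (cong suc (rank-iterate h (par x) ne))
    where x≢c : x ≢ c
          x≢c refl = ne (iterate-root rooted (suc h))

  iterate-≥rank : ∀ k x → rank x ≤ k → (par ^[ k ]) x ≡ c
  iterate-≥rank k x le with x ≟ c
  ... | yes refl = iterate-root rooted k
  iterate-≥rank zero x le | no x≢c = contradiction (subst (_≤ 0) (rank-suc x≢c) le) λ ()
  iterate-≥rank (suc k) x le | no x≢c =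
    iterate-≥rank k (par x) (s≤s⁻¹ (subst (_≤ suc k) (rank-suc x≢c) le))

  rank-iterate-≤ : ∀ h x → h ≤ rank x → rank x ≡ h + rank ((par ^[ h ]) x)
  rank-iterate-≤ zero    x le = refl
  rank-iterate-≤ (suc h) x le with x ≟ c
  ... | yes refl = contradiction (subst (suc h ≤_) rank-root le) λ ()
  ... | no x≢c = trans (rank-suc x≢c)
    (cong suc (rank-iterate-≤ h (par x) (s≤s⁻¹ (subst (suc h ≤_) (rank-suc x≢c) le))))

  -- The ancestors of x at steps 0 to `rank x` have different ranks and are therefore distinct
  -- vertices.
  rank<n : ∀ x → rank x < n
  rank<n x = injective⇒≤ {f = λ i → (par ^[ toℕ i ]) x} λ {i} {j} eq → toℕ-injective
    (+-cancelʳ-≡ (rank ((par ^[ toℕ i ]) x)) (toℕ i) (toℕ j)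
      (trans (sym (rank-iterate-≤ (toℕ i) x (s≤s⁻¹ (toℕ<n i))))
        (trans (rank-iterate-≤ (toℕ j) x (s≤s⁻¹ (toℕ<n j)))
          (cong (λ a → toℕ j + rank a) (sym eq)))))

  Within-rank : ∀ x → Within G (rank x) c x
  Within-rank x = subst (λ a → Within G (rank x) a x) (iterate-≥rank (rank x) x ≤-refl)
    (Within-iterate rooted (rank x) x)

module _ {n} {G : Graph n} (tree : IsTree G) where

  -- A `dist` equal to n could be a failed search. Rooting at u and using `rank<n` excludes that.
  ecc≤⇒Within : ∀ {ℓ v} → ecc G v ≤ ℓ → ∀ u → Within G ℓ v u
  ecc≤⇒Within {ℓ} {v} le u = Within-sym (proj₁ tree)
    (Within-mono (≤-trans (dist≤ecc {G = G} u v) le)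
      (dist<n⇒Within (≤-<-trans (Within⇒dist≤ (Within-rank R v)) (rank<n R v))))
    where R = distanceRooted tree u

  Within⇒ecc≤ : ∀ {ℓ v} → (∀ u → Within G ℓ v u) → ecc G v ≤ ℓ
  Within⇒ecc≤ h = ecc-≤ λ u → Within⇒dist≤ (Within-sym (proj₁ tree) (h u))

iterate-comm : ∀ {A : Set} (f : A → A) k x → (f ^[ k ]) (f x) ≡ f ((f ^[ k ]) x)
iterate-comm f zero    x = refl
iterate-comm f (suc k) x = iterate-comm f k (f x)

-- Eccentricity along parent paths, and the centre.

Spans : ∀ {n} → Graph n → ℕ → Fin n → Set
Spans G ℓ v = ∀ u → Within G ℓ v u

module _ {n} {G : Graph n} {c : Fin n} (R : DistanceRooted G c) {r : ℕ} (spans-c : Spans G r c) where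
  open DistanceRooted R

  -- A walk can leave the subtree below z only by stepping from z to its parent, and what remains is
  -- shorter. The induction is on the last edge.
  below-or-through : ∀ {z m x} → z ≢ c → Within G m z x →
    (∃ λ h → (par ^[ h ]) x ≡ z) ⊎ (∃ λ m′ → m ≡ suc m′ × Within G m′ (par z) x)
  below-or-through z≢c stay = inj₁ (0 , refl)
  below-or-through z≢c (q ▷ a) with below-or-through z≢c q
  ... | inj₂ (m′ , refl , q′) = inj₂ (_ , refl , q′ ▷ a)
  ... | inj₁ (h , eq) with adj-inv a
  ...   | inj₁ (_ , refl) = inj₁ (suc h , eq)
  below-or-through z≢c (q ▷ a) | inj₁ (zero , refl) | inj₂ (_ , refl) = inj₂ (_ , refl , stay)
  below-or-through z≢c (q ▷ a) | inj₁ (suc h , eq)  | inj₂ (_ , refl) = inj₁ (h , eq)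

  below-rank : ∀ {z x} h → z ≢ c → (par ^[ h ]) x ≡ z → suc h + rank (par z) ≤ r
  below-rank {x = x} h z≢c refl = subst (_≤ r) eq (rank-least (spans-c x))
    where
    eq : rank x ≡ suc h + rank (par ((par ^[ h ]) x))
    eq = trans (rank-iterate R h x z≢c) (trans (cong (h +_) (rank-suc z≢c)) (+-suc h _))

  below-Within : ∀ {z x} h → z ≢ c → (par ^[ h ]) x ≡ z → Within G (suc h) (par z) x
  below-Within {x = x} h z≢c refl = Within-trans (stay ▷ par-adj z≢c) (Within-iterate rooted h x)

  -- Vertices reached through `par z` are one step closer to it than to z; those below z lie within
  -- r of it by `below-rank`.
  spans-par : ∀ {z s} → z ≢ c → r ≤ s → Spans G (suc s) z → Spans G s (par z)
  spans-par z≢c r≤s spans-z x with below-or-through z≢c (spans-z x)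
  ... | inj₂ (_ , refl , q) = q
  ... | inj₁ (h , eq) = Within-mono
    (≤-trans (m≤m+n (suc h) _) (≤-trans (below-rank h z≢c eq) r≤s)) (below-Within h z≢c eq)

  -- Each parent step lowers the excess over r by one, so k steps end in A. If c is met earlier, the
  -- iteration stays there.
  spans-iterate : (A : Fin n → Bool) → A c ≡ true → (∀ x → Spans G r x → A x ≡ true) →
    ∀ k x → Spans G (k + r) x → A ((par ^[ k ]) x) ≡ true
  spans-iterate A Ac As zero    x sp = As x sp
  spans-iterate A Ac As (suc k) x sp with x ≟ c
  ... | yes refl = trans (cong A (iterate-root rooted (suc k))) Ac
  ... | no x≢c   = spans-iterate A Ac As k (par x) (spans-par x≢c (m≤n+m r k) sp)

  module _ (minimal : ∀ {v s} → Spans G s v → r ≤ s) {z : Fin n} (z≢c : z ≢ c) (spans-z : Spans G r z) where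

    radius-suc : ∃ λ s → r ≡ suc s
    radius-suc = pred r , sym (suc-pred r {{>-nonZero (≤-trans (s≤s z≤n) (below-rank 0 z≢c refl))}})

    -- Otherwise `par z` has positive depth, so every vertex below z lies within r - 1 of it; so do
    -- those reached from z through `par z`. This contradicts the minimality of r.
    central-child : par z ≡ c
    central-child with radius-suc | par z ≟ c
    ... | _        | yes p  = p
    ... | s , r≡ | no p≢c = contradiction (subst (_≤ s) r≡ (minimal {par z} {s} closer)) 1+n≰n
      where
      closer : Spans G s (par z)
      closer x with below-or-through z≢c (spans-z x)
      ... | inj₂ (m , r≡′ , q) = subst (λ a → Within G a (par z) x) (suc-injective (trans (sym r≡′) r≡)) q
      ... | inj₁ (h , eq) = Within-mono
        (s≤s⁻¹ (begin
          2 + h                              ≤⟨ s≤s (m≤m+n (suc h) (rank (par (par z)))) ⟩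
          2 + h + rank (par (par z))         ≡⟨ +-suc (suc h) _ ⟨
          1 + h + suc (rank (par (par z)))   ≡⟨ cong (suc h +_) (rank-suc p≢c) ⟨
          1 + h + rank (par z)               ≤⟨ below-rank h z≢c eq ⟩
          r                                  ≡⟨ r≡ ⟩
          suc s                              ∎))
        (below-Within h z≢c eq)
        where open ≤-Reasoning hiding (start)

    -- If x is reached through `par z`, which is c, its depth is at most s. Otherwise z is its
    -- ancestor at some step h ≤ s, and any remaining step leads to c.
    bicentral-cover : ∀ {s} → r ≡ suc s → ∀ x → (par ^[ s ]) x ≡ c ⊎ (par ^[ s ]) x ≡ z
    bicentral-cover {s} r≡ x with below-or-through z≢c (spans-z x)
    ... | inj₂ (m , r≡′ , q) with refl ← suc-injective (trans (sym r≡′) r≡) =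
      inj₁ (iterate-≥rank R s x (rank-least (subst (λ a → Within G s a x) central-child q)))
    ... | inj₁ (h , eq) with m≤n⇒∃[o]m+o≡n
      (s≤s⁻¹ (≤-trans (m≤m+n (suc h) _) (≤-trans (below-rank h z≢c eq) (≤-reflexive r≡))))
    ...   | i , refl = descend i (trans (split h i x) (cong (par ^[ i ]) eq))
      where
      split : ∀ h i x → (par ^[ h + i ]) x ≡ (par ^[ i ]) ((par ^[ h ]) x)
      split zero    i x = refl
      split (suc h) i x = split h i (par x)
      descend : ∀ i → (par ^[ h + i ]) x ≡ (par ^[ i ]) z → (par ^[ h + i ]) x ≡ c ⊎ (par ^[ h + i ]) x ≡ z
      descend zero    p = inj₂ p
      descend (suc i) p = inj₁ (trans p (trans (cong (par ^[ i ]) central-child) (iterate-root rooted i)))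

module _ {n} {G : Graph n} (tree : IsTree G) {c : Fin n} {r : ℕ} (spans-c : Spans G r c)
         (minimal : ∀ {v s} → Spans G s v → r ≤ s) where

  -- For a third vertex y, `central-child` with root z makes y and z adjacent, while with root c it
  -- makes c the parent of both.
  centre-size : ∀ {z y} → z ≢ c → Spans G r z → Spans G r y → y ≡ c ⊎ y ≡ z
  centre-size {z} {y} z≢c spans-z spans-y with y ≟ c | y ≟ z
  ... | yes p | _     = inj₁ p
  ... | no _  | yes p = inj₂ p
  ... | no y≢c | no y≢z =
    ⊥-elim (impossible (adj-inv (subst (λ a → Adj G y a) yz (DistanceRooted.adj-par Rz y≢z))))
    where
    Rc = distanceRooted tree c
    Rz = distanceRooted tree z
    open DistanceRooted Rc
    yz : DistanceRooted.par Rz y ≡ z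
    yz = central-child Rz spans-z minimal y≢z spans-y
    impossible : ¬ ((z ≢ c × y ≡ par z) ⊎ (y ≢ c × z ≡ par y))
    impossible (inj₁ (_ , p)) = y≢c (trans p (central-child Rc spans-c minimal z≢c spans-z))
    impossible (inj₂ (_ , p)) = z≢c (trans p (central-child Rc spans-c minimal y≢c spans-y))

-- Degree sums and neighbourhood bounds.

sum-take-∷ : ∀ {d ds} → Linked _≥_ (d ∷ ds) → ∀ k → sum (take k ds) ≤ sum (take k (d ∷ ds))
sum-take-∷ l zero = z≤n
sum-take-∷ [-] (suc k) = z≤n
sum-take-∷ (d≥ ∷ l) (suc k) = +-mono-≤ d≥ (sum-take-∷ l k)

majorize : ∀ {A : Set} (f : A → ℕ) (P : A → Bool) xs → Linked _≥_ (map f xs) →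
  sum (map (λ x → ⟦ P x ⟧ * f x) xs) ≤ sum (take (sum (map (λ x → ⟦ P x ⟧) xs)) (map f xs))
majorize f P []       l = z≤n
majorize f P (x ∷ xs) l with P x
... | true  = +-mono-≤ (≤-reflexive (+-identityʳ (f x))) (majorize f P xs (Linked.tail l))
... | false = ≤-trans (majorize f P xs (Linked.tail l)) (sum-take-∷ l (sum (map (λ x → ⟦ P x ⟧) xs)))

∑-majorize : ∀ {n} {f : Fin n → ℕ} {ds} → Linked _≥_ ds → map f (allFin n) ↭ ds → (P : Fin n → Bool) →
  ∑ (λ x → ⟦ P x ⟧ * f x) ≤ sum (take (∑ (λ x → ⟦ P x ⟧)) ds)
-- Pulling the permutation back to the vertices lists them by non-increasing `f`; both sums are
-- invariant under this reordering.
∑-majorize {n} {f} l p P with ↭-map-inv f p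
... | xs , refl , q = subst₂ (λ a b → a ≤ sum (take b (map f xs)))
  (sym (sum-↭ (map⁺ (λ x → ⟦ P x ⟧ * f x) q)))
  (sym (sum-↭ (map⁺ (λ x → ⟦ P x ⟧) q)))
  (majorize f P xs l)

start-suc : ∀ ds m → start ds (suc m) ≡ start ds m + down ds m
start-suc ds m = cong suc (begin
  sum (map (down ds) (upTo (suc m)))
    ≡⟨ cong (sum ∘ map (down ds)) (upTo-∷ʳ m) ⟨
  sum (map (down ds) (upTo m ∷ʳ m))
    ≡⟨ cong sum (map-++ (down ds) (upTo m) (m ∷ [])) ⟩
  sum (map (down ds) (upTo m) ++ down ds m ∷ [])
    ≡⟨ sum-++ (map (down ds) (upTo m)) (down ds m ∷ []) ⟩
  sum (map (down ds) (upTo m)) + (down ds m + 0)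
    ≡⟨ cong (sum (map (down ds) (upTo m)) +_) (+-identityʳ _) ⟩
  sum (map (down ds) (upTo m)) + down ds m ∎)
  where open ≡-Reasoning

start-mono : ∀ ds {i j} → i ≤ j → start ds i ≤ start ds j
start-mono ds i≤j = go (≤⇒≤′ i≤j)
  where
  go : ∀ {i j} → i ≤′ j → start ds i ≤ start ds j
  go ≤′-refl           = ≤-refl
  go (≤′-step {j} i≤j) = ≤-trans (go i≤j) (≤-trans (m≤m+n _ (down ds j)) (≤-reflexive (sym (start-suc ds j))))

sum-take-suc : ∀ ds m → sum (take (suc m) ds) ≡ sum (take m ds) + nthOr0 ds m
sum-take-suc []       zero    = refl
sum-take-suc []       (suc m) = refl
sum-take-suc (d ∷ ds) zero    = +-identityʳ d
sum-take-suc (d ∷ ds) (suc m) = trans (cong (d +_) (sum-take-suc ds m)) (sym (+-assoc d _ _))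

-- Makes the truncated subtraction in `down` exact. The head is exempt, since a one-vertex tree has
-- degree 0.
PositiveTail : List ℕ → Set
PositiveTail ds = ∀ {i} → suc i < length ds → 1 ≤ nthOr0 ds (suc i)

-- The closed form of `start`, put additively to match `neighbourhood-count`. It begins at one
-- vertex: at 0 it would give 2, whereas `start ds 0` is 1.
start-sum : ∀ {ds} → PositiveTail ds → ∀ {m} → m < length ds →
  start ds (suc m) + suc m ≡ sum (take (suc m) ds) + 2
start-sum {ds} pos {zero} _ = begin
  start ds 1 + 1           ≡⟨ cong (_+ 1) (start-suc ds 0) ⟩
  suc (nthOr0 ds 0) + 1    ≡⟨ +-suc (nthOr0 ds 0) 1 ⟨
  nthOr0 ds 0 + 2          ≡⟨ cong (_+ 2) (sum-take-suc ds 0) ⟨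
  sum (take 1 ds) + 2      ∎
  where open ≡-Reasoning
start-sum {ds} pos {suc m} lt = begin
  start ds (2 + m) + (2 + m)
    ≡⟨ cong (_+ (2 + m)) (start-suc ds (suc m)) ⟩
  start ds (1 + m) + (d ∸ 1) + (2 + m)
    ≡⟨ regroup (start ds (1 + m)) (d ∸ 1) m ⟩
  start ds (1 + m) + (1 + m) + (1 + (d ∸ 1))
    ≡⟨ cong₂ _+_ (start-sum pos (<-trans ≤-refl lt)) (m+[n∸m]≡n (pos lt)) ⟩
  sum (take (1 + m) ds) + 2 + d
    ≡⟨ regroup′ (sum (take (1 + m) ds)) d ⟩
  sum (take (1 + m) ds) + d + 2
    ≡⟨ cong (_+ 2) (sum-take-suc ds (suc m)) ⟨
  sum (take (2 + m) ds) + 2 ∎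
  where
  open ≡-Reasoning
  d = nthOr0 ds (suc m)
  regroup : ∀ a b m → a + b + (2 + m) ≡ a + (1 + m) + (1 + b)
  regroup = solve-∀
  regroup′ : ∀ a d → a + 2 + d ≡ a + d + 2
  regroup′ = solve-∀

nthOr0-All : ∀ {P : ℕ → Set} {ds} → All P ds → ∀ {i} → i < length ds → P (nthOr0 ds i)
nthOr0-All (p ∷ _)  {zero}  _        = p
nthOr0-All (_ ∷ ps) {suc i} (s≤s lt) = nthOr0-All ps lt

module _ {n} {G : Graph n} (tree : IsTree G) where

  -- With the root at another vertex, y has a parent.
  degree-positive : 1 < n → ∀ y → 1 ≤ degree G y
  degree-positive 1<n y with other 1<n y
    where
    other : ∀ {n} → 1 < n → (y : Fin n) → ∃ λ u → u ≢ y
    other (s≤s (s≤s _)) zero    = suc zero , λ ()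
    other (s≤s (s≤s _)) (suc _) = zero , λ ()
  ... | u , u≢y with u ≟ y | degree-fibre (DistanceRooted.rooted (distanceRooted tree u)) y
  ...   | yes u≡y | _  = contradiction u≡y u≢y
  ...   | no _    | eq = subst (1 ≤_) (trans (sym eq) (+-identityʳ _)) (m≤n+m 1 _)

  -- The set of all vertices is its own preimage under `par`, so this is `neighbourhood-count` for
  -- that set.
  handshake : Fin n → n + n ≡ sum (degSeq G) + 2
  handshake c = begin
    n + n
      ≡⟨ cong₂ _+_ (∑-one n) (∑-one n) ⟨
    ∑ {n} (λ _ → 1) + ∑ {n} (λ _ → 1)
      ≡⟨ neighbourhood-count (DistanceRooted.rooted (distanceRooted tree c)) (λ _ → true) refl ⟩
    ∑ (λ y → 1 * degree G y) + 2
      ≡⟨ cong (_+ 2) (∑-cong λ y → *-identityˡ (degree G y)) ⟩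
    sum (degSeq G) + 2 ∎
    where open ≡-Reasoning

  module _ {ds} (perm : degSeq G ↭ ds) (len : length ds ≡ n) where

    positive-tail : PositiveTail ds
    positive-tail {i} lt = nthOr0-All {1 ≤_} (All-resp-↭ perm (All.map⁺ (All.tabulate λ {y} _ →
      degree-positive (subst (1 <_) len (≤-<-trans (s≤s z≤n) lt)) y))) lt

    start-total : Fin n → start ds n ≡ n
    start-total c = total len (handshake c)
      where
      total : ∀ {n} → length ds ≡ n → n + n ≡ sum (degSeq G) + 2 → start ds n ≡ n
      total {zero}  _   eq = contradiction (trans eq (+-comm _ 2)) λ ()
      total {suc m} len eq = +-cancelʳ-≡ (suc m) _ _ (trans
        (start-sum positive-tail (≤-reflexive (sym len)))
        (trans (cong (_+ 2) (trans (cong sum (take-all (suc m) ds (≤-reflexive len))) (sym (sum-↭ perm)))) (sym eq)))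

    module _ (sorted : Linked _≥_ ds) {c : Fin n} (R : Rooted G c) where
      open Rooted R

      -- The degree sum over A is at most that of the largest |A| degrees; then
      -- `neighbourhood-count` and `start-sum` differ only in the term to be compared. Since c is in
      -- A, |A| is at least 1, where `start-sum` begins.
      neighbourhood-bound : (A : Fin n → Bool) → A c ≡ true →
        ∑ (λ x → ⟦ A (par x) ⟧) ≤ start ds (∑ (λ x → ⟦ A x ⟧))
      neighbourhood-bound A Ac = bound _ refl
        where
        size≥1 : 1 ≤ ∑ (λ x → ⟦ A x ⟧)
        size≥1 = subst (_≤ ∑ (λ x → ⟦ A x ⟧)) (∑-point c) (∑-mono pointwise)
          where pointwise : ∀ x → ⟦ does (c ≟ x) ⟧ ≤ ⟦ A x ⟧
                pointwise x with c ≟ x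
                ... | yes refl = ≤-reflexive (sym (cong ⟦_⟧ Ac))
                ... | no _     = z≤n
        size≤n : ∑ (λ x → ⟦ A x ⟧) ≤ length ds
        size≤n = subst (∑ (λ x → ⟦ A x ⟧) ≤_) (trans (∑-one n) (sym len)) (∑-mono λ x → ⟦⟧≤1 (A x))
          where ⟦⟧≤1 : ∀ b → ⟦ b ⟧ ≤ 1
                ⟦⟧≤1 true  = ≤-refl
                ⟦⟧≤1 false = z≤n
        bound : ∀ m → ∑ (λ x → ⟦ A x ⟧) ≡ m → ∑ (λ x → ⟦ A (par x) ⟧) ≤ start ds m
        bound zero    eq = contradiction (subst (1 ≤_) eq size≥1) λ ()
        bound (suc m) eq = +-cancelʳ-≤ (suc m) _ _ (begin
          ∑ (λ x → ⟦ A (par x) ⟧) + suc m                  ≡⟨ cong (∑ (λ x → ⟦ A (par x) ⟧) +_) eq ⟨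
          ∑ (λ x → ⟦ A (par x) ⟧) + ∑ (λ x → ⟦ A x ⟧)      ≡⟨ neighbourhood-count R A Ac ⟩
          ∑ (λ y → ⟦ A y ⟧ * degree G y) + 2               ≤⟨ +-monoˡ-≤ 2 (∑-majorize sorted perm A) ⟩
          sum (take (∑ (λ x → ⟦ A x ⟧)) ds) + 2            ≡⟨ cong (λ a → sum (take a ds) + 2) eq ⟩
          sum (take (suc m) ds) + 2                        ≡⟨ start-sum positive-tail (subst (_≤ length ds) eq size≤n) ⟨
          start ds (suc m) + suc m                         ∎)
          where open ≤-Reasoning hiding (start)

      iterated-bound : (A : Fin n → Bool) → A c ≡ true → ∀ {m} → ∑ (λ x → ⟦ A x ⟧) ≤ m →
        ∀ k → ∑ (λ x → ⟦ A ((par ^[ k ]) x) ⟧) ≤ (start ds ^[ k ]) m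
      iterated-bound A Ac A≤m zero = A≤m
      iterated-bound A Ac {m} A≤m (suc k) = begin
        ∑ (λ x → ⟦ A ((par ^[ k ]) (par x)) ⟧)
          ≤⟨ neighbourhood-bound (A ∘ (par ^[ k ])) (trans (cong A (iterate-root R k)) Ac) ⟩
        start ds (∑ (λ x → ⟦ A ((par ^[ k ]) x) ⟧))
          ≤⟨ start-mono ds (iterated-bound A Ac A≤m k) ⟩
        start ds ((start ds ^[ k ]) m)
          ≡⟨ iterate-comm (start ds) k m ⟨
        (start ds ^[ suc k ]) m ∎
        where open ≤-Reasoning hiding (start)

-- The greedy tree.

nthOr0-mono : ∀ {ds} → Linked _≥_ ds → ∀ {i j} → i ≤ j → nthOr0 ds j ≤ nthOr0 ds i
nthOr0-mono []       _       = z≤n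
nthOr0-mono {d ∷ _} [-] {zero} {zero} _ = ≤-refl
nthOr0-mono [-] {zero} {suc j} _ = z≤n
nthOr0-mono [-] {suc i} {suc j} _ = z≤n
nthOr0-mono (_ ∷ l) {zero} {zero} _ = ≤-refl
nthOr0-mono (d≥ ∷ l) {zero} {suc j} _ = ≤-trans (nthOr0-mono l {0} {j} z≤n) d≥
nthOr0-mono (_ ∷ l) {suc i} {suc j} (s≤s i≤j) = nthOr0-mono l i≤j

nthOr0-≥length : ∀ ds {i} → length ds ≤ i → nthOr0 ds i ≡ 0
nthOr0-≥length []       _         = refl
nthOr0-≥length (d ∷ ds) (s≤s len) = nthOr0-≥length ds len

map-nthOr0 : ∀ ds → map (nthOr0 ds ∘ toℕ) (allFin (length ds)) ≡ ds
map-nthOr0 []       = refl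
map-nthOr0 (d ∷ ds) = trans (map-allFin-suc (nthOr0 (d ∷ ds) ∘ toℕ)) (cong (d ∷_) (map-nthOr0 ds))

⟦⟧-T : ∀ {b} → T b → ⟦ b ⟧ ≡ 1
⟦⟧-T {true} _ = refl

⟦⟧-¬T : ∀ {b} → ¬ T b → ⟦ b ⟧ ≡ 0
⟦⟧-¬T {true}  ¬b = ⊥-elim (¬b _)
⟦⟧-¬T {false} _  = refl

⟦<⟧-yes : ∀ {m n} → m < n → ⟦ m <ᵇ n ⟧ ≡ 1
⟦<⟧-yes lt = ⟦⟧-T (<⇒<ᵇ lt)

⟦<⟧-no : ∀ {m n} → n ≤ m → ⟦ m <ᵇ n ⟧ ≡ 0
⟦<⟧-no {m} {n} le = ⟦⟧-¬T (λ t → <-irrefl refl (<-≤-trans (<ᵇ⇒< m n t) le))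

module Greedy (ds : List ℕ) (sorted : Linked _≥_ ds) (nonempty : 0 < length ds)
              (pos : PositiveTail ds) (total : start ds (length ds) ≡ length ds) where

  private
    n = length ds
    G = greedy ds

  down-≥n : ∀ {m} → n ≤ m → down ds m ≡ 0
  down-≥n {zero}  le = nthOr0-≥length ds le
  down-≥n {suc m} le = cong (_∸ 1) (nthOr0-≥length ds le)

  -- Past the end of the list the default degree 0 keeps `start` at its value n.
  start-≤n : ∀ m → start ds m ≤ n
  start-≤n m with m ≤? n
  ... | yes m≤n = ≤-trans (start-mono ds m≤n) (≤-reflexive total)
  start-≤n zero | no m≰n = contradiction z≤n m≰n
  start-≤n (suc m) | no m≰n = begin
    start ds (suc m)        ≡⟨ start-suc ds m ⟩
    start ds m + down ds m  ≡⟨ cong (start ds m +_) (down-≥n (s≤s⁻¹ (≰⇒> m≰n))) ⟩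
    start ds m + 0          ≡⟨ +-identityʳ _ ⟩
    start ds m              ≤⟨ start-≤n m ⟩
    n                       ∎
    where open ≤-Reasoning hiding (start)

  -- Degrees ≥ 2 keep the queue of unprocessed vertices growing; from the first leaf on it
  -- already contains all remaining vertices.
  start-> : ∀ {i} → i < n → i < start ds i
  start-> {zero}  _   = s≤s z≤n
  start-> {suc i} i<n with 2 ≤? nthOr0 ds (suc i)
  ... | yes 2≤d = branching (suc i) ≤-refl
    where
    down≥1 : ∀ m → m ≤ suc i → 1 ≤ down ds m
    down≥1 zero    le = ≤-trans (s≤s z≤n) (≤-trans 2≤d (nthOr0-mono sorted le))
    down≥1 (suc m) le = ∸-monoˡ-≤ 1 (≤-trans 2≤d (nthOr0-mono sorted le))
    branching : ∀ m → m ≤ suc i → m < start ds m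
    branching zero    _  = s≤s z≤n
    branching (suc m) le = begin
      2 + m                   ≤⟨ s≤s (branching m (<⇒≤ le)) ⟩
      1 + start ds m          ≡⟨ +-comm 1 _ ⟩
      start ds m + 1          ≤⟨ +-monoʳ-≤ (start ds m) (down≥1 m (<⇒≤ le)) ⟩
      start ds m + down ds m  ≡⟨ start-suc ds m ⟨
      start ds (suc m)        ∎
      where open ≤-Reasoning hiding (start)
  ... | no 2≰d = subst (suc i <_) (trans (sym total) (leaves (≤⇒≤′ (<⇒≤ i<n)))) i<n
    where
    leaves : ∀ {m} → suc i ≤′ m → start ds m ≡ start ds (suc i)
    leaves ≤′-refl = refl
    leaves (≤′-step {zero} le)  = contradiction (≤′⇒≤ le) λ ()
    leaves (≤′-step {suc m} le) = trans (start-suc ds (suc m)) (trans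
      (cong (start ds (suc m) +_) (m≤n⇒m∸n≡0 (≤-trans (nthOr0-mono sorted (≤′⇒≤ le)) (s≤s⁻¹ (≰⇒> 2≰d)))))
      (trans (+-identityʳ _) (leaves le)))

  record Child (i j : ℕ) : Set where
    constructor child
    field
      lower : start ds i ≤ j
      upper : j < start ds (suc i)
  open Child

  isChild⇒Child : ∀ i j → T (isChild ds i j) → Child i j
  isChild⇒Child i j t with to (T-∧ {start ds i ≤ᵇ j}) t
  ... | p , q = child (≤ᵇ⇒≤ _ _ p) (<-≤-trans (<ᵇ⇒< j _ q) (≤-reflexive (sym (start-suc ds i))))

  Child⇒isChild : ∀ {i j} → Child i j → T (isChild ds i j)
  Child⇒isChild {i} (child p q) = from T-∧ (≤⇒≤ᵇ p , <⇒<ᵇ (<-≤-trans q (≤-reflexive (start-suc ds i))))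

  Child-unique : ∀ {i i′ j} → Child i j → Child i′ j → i ≡ i′
  Child-unique p q = ≤-antisym (below p q) (below q p)
    where
    below : ∀ {i i′ j} → Child i j → Child i′ j → i ≤ i′
    below {i} {i′} (child p _) (child _ q) with i ≤? i′
    ... | yes le = le
    ... | no i≰  = ⊥-elim (<-irrefl refl (<-≤-trans q (≤-trans (start-mono ds (≰⇒> i≰)) p)))

  -- The child blocks of the vertices before m tile the labels from `start ds 0`, which is 1, up to
  -- `start ds m`.
  locate : ∀ {j} → 1 ≤ j → ∀ m → j < start ds m → ∃ λ i → i < m × Child i j
  locate 1≤j zero    lt = contradiction (<-≤-trans lt 1≤j) (<-irrefl refl)
  locate {j} 1≤j (suc m) lt with j <? start ds m
  ... | no j≮ = m , ≤-refl , child (≮⇒≥ j≮) lt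
  ... | yes j< with locate 1≤j m j<
  ...   | i , i<m , ch = i , <-trans i<m ≤-refl , ch

  root : Fin n
  root = fromℕ< nonempty

  toℕ-root : toℕ root ≡ 0
  toℕ-root = toℕ-fromℕ< nonempty

  ≢root⇒1≤ : ∀ {v} → v ≢ root → 1 ≤ toℕ v
  ≢root⇒1≤ v≢ = n≢0⇒n>0 λ eq → v≢ (toℕ-injective (trans eq (sym toℕ-root)))

  Child⇒≢root : ∀ {i v} → Child i (toℕ v) → v ≢ root
  Child⇒≢root {i} (child p _) refl = contradiction (subst (start ds i ≤_) toℕ-root p) λ ()

  private abstract
    parent : ∀ v → ∃ λ w → (v ≡ root × w ≡ root) ⊎ Child (toℕ w) (toℕ v)
    parent v with v ≟ root
    ... | yes v≡ = root , inj₁ (v≡ , refl)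
    -- By `total` the blocks of all n vertices exhaust the labels.
    ... | no v≢ with locate (≢root⇒1≤ v≢) n (<-≤-trans (toℕ<n v) (≤-reflexive (sym total)))
    ...   | i , i<n , ch = fromℕ< i<n , inj₂ (subst (λ a → Child a (toℕ v)) (sym (toℕ-fromℕ< i<n)) ch)

  par : Fin n → Fin n
  par v = proj₁ (parent v)

  par-root : par root ≡ root
  par-root with parent root
  ... | _ , inj₁ (_ , p) = p
  ... | _ , inj₂ ch = contradiction refl (Child⇒≢root ch)

  par-child : ∀ {v} → v ≢ root → Child (toℕ (par v)) (toℕ v)
  par-child {v} v≢ with parent v
  ... | _ , inj₁ (v≡ , _) = contradiction v≡ v≢
  ... | _ , inj₂ ch = ch

  Child⇒par : ∀ {u v} → Child (toℕ u) (toℕ v) → u ≡ par v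
  Child⇒par ch = toℕ-injective (Child-unique ch (par-child (Child⇒≢root ch)))

  -- The label serves as rank: by `start->` children carry larger labels than their parent.
  greedy-rooted : Rooted G root
  greedy-rooted = record
    { par = par ; rank = toℕ ; par-root = par-root
    ; rank-par = λ {v} v≢ → <-≤-trans (start-> (toℕ<n (par v))) (lower (par-child v≢))
    ; par-adj = λ v≢ → from T-∨ (inj₁ (Child⇒isChild (par-child v≢)))
    ; adj-par = λ {v} v≢ → from (T-∨ {isChild ds (toℕ v) (toℕ (par v))}) (inj₂ (Child⇒isChild (par-child v≢)))
    ; adj-inv = adj-inv }
    where
    adj-inv : ∀ {u v} → Adj G u v → (v ≢ root × u ≡ par v) ⊎ (u ≢ root × v ≡ par u)
    adj-inv {u} {v} a with to (T-∨ {isChild ds (toℕ u) (toℕ v)}) a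
    ... | inj₁ t = let ch = isChild⇒Child (toℕ u) (toℕ v) t in inj₁ (Child⇒≢root ch , Child⇒par ch)
    ... | inj₂ t = let ch = isChild⇒Child (toℕ v) (toℕ u) t in inj₂ (Child⇒≢root ch , Child⇒par ch)

  private
    -- The labels before the end of the block of y are those before its beginning and the block
    -- itself; the product accounts for the root being its own parent. Summing over x measures the
    -- fibre.
    fibre-split : ∀ y x →
      ⟦ toℕ x <ᵇ start ds (toℕ y) ⟧ + ⟦ does (par x ≟ y) ⟧
        ≡ ⟦ toℕ x <ᵇ start ds (suc (toℕ y)) ⟧ + ⟦ does (root ≟ y) ⟧ * ⟦ does (root ≟ x) ⟧
    fibre-split y x with root ≟ x
    fibre-split y x | yes refl rewrite par-root =
      cong₂ _+_ (trans (⟦<⟧-yes (subst (_< start ds (toℕ y)) (sym toℕ-root) (s≤s z≤n)))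
                       (sym (⟦<⟧-yes (subst (_< start ds (suc (toℕ y))) (sym toℕ-root) (s≤s z≤n)))))
                (sym (*-identityʳ ⟦ does (root ≟ y) ⟧))
    fibre-split y x | no r≢x rewrite *-zeroʳ ⟦ does (root ≟ y) ⟧ with par x ≟ y
    ... | yes refl = let child p q = par-child (λ x≡ → r≢x (sym x≡)) in
      trans (cong (_+ 1) (⟦<⟧-no p)) (sym (trans (+-identityʳ _) (⟦<⟧-yes q)))
    ... | no px≢y with toℕ x <? start ds (toℕ y)
    ...   | yes lt = cong (_+ 0) (trans (⟦<⟧-yes lt)
      (sym (⟦<⟧-yes (<-≤-trans lt (start-mono ds (n≤1+n (toℕ y)))))))
    ...   | no ≮ = cong (_+ 0) (trans (⟦<⟧-no (≮⇒≥ ≮))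
      (sym (⟦<⟧-no (≮⇒≥ λ lt → px≢y (sym (Child⇒par (child (≮⇒≥ ≮) lt)))))))

    fibre-greedy : ∀ y → fibre greedy-rooted y ≡ down ds (toℕ y) + ⟦ does (root ≟ y) ⟧
    fibre-greedy y = +-cancelˡ-≡ (start ds (toℕ y)) _ _ (begin
      start ds (toℕ y) + fibre greedy-rooted y
        ≡⟨ cong (_+ fibre greedy-rooted y) (∑-< (start-≤n (toℕ y))) ⟨
      ∑ {n} (λ x → ⟦ toℕ x <ᵇ start ds (toℕ y) ⟧) + fibre greedy-rooted y
        ≡⟨ ∑-+ {n} (λ x → ⟦ toℕ x <ᵇ start ds (toℕ y) ⟧) (λ x → ⟦ does (par x ≟ y) ⟧) ⟨
      ∑ (λ x → ⟦ toℕ x <ᵇ start ds (toℕ y) ⟧ + ⟦ does (par x ≟ y) ⟧)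
        ≡⟨ ∑-cong (fibre-split y) ⟩
      ∑ {n} (λ x → ⟦ toℕ x <ᵇ start ds (suc (toℕ y)) ⟧ + e * ⟦ does (root ≟ x) ⟧)
        ≡⟨ ∑-+ {n} (λ x → ⟦ toℕ x <ᵇ start ds (suc (toℕ y)) ⟧) (λ x → e * ⟦ does (root ≟ x) ⟧) ⟩
      ∑ {n} (λ x → ⟦ toℕ x <ᵇ start ds (suc (toℕ y)) ⟧) + ∑ {n} (λ x → e * ⟦ does (root ≟ x) ⟧)
        ≡⟨ cong₂ _+_ (∑-< (start-≤n (suc (toℕ y))))
             (trans (∑-* {n} e (λ x → ⟦ does (root ≟ x) ⟧)) (cong (e *_) (∑-point root))) ⟩
      start ds (suc (toℕ y)) + e * 1
        ≡⟨ cong₂ _+_ (start-suc ds (toℕ y)) (*-identityʳ e) ⟩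
      start ds (toℕ y) + down ds (toℕ y) + e
        ≡⟨ +-assoc (start ds (toℕ y)) _ _ ⟩
      start ds (toℕ y) + (down ds (toℕ y) + e) ∎)
      where
      open ≡-Reasoning
      e = ⟦ does (root ≟ y) ⟧

  degree-greedy : ∀ y → degree G y ≡ nthOr0 ds (toℕ y)
  degree-greedy y with root ≟ y | trans (degree-fibre greedy-rooted y) (cong (_+ 1) (fibre-greedy y))
  ... | yes refl | eq = +-cancelʳ-≡ 2 _ _ (trans eq (trans (+-assoc _ 1 1)
          (cong (_+ 2) (subst (λ i → down ds i ≡ nthOr0 ds i) (sym toℕ-root) refl))))
  ... | no r≢y | eq = trans (sym (+-identityʳ _)) (trans eq (trans (cong (_+ 1) (+-identityʳ _))
          (shift (toℕ y) (≢root⇒1≤ λ y≡ → r≢y (sym y≡)) (toℕ<n y))))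
    where
    shift : ∀ i → 1 ≤ i → i < n → down ds i + 1 ≡ nthOr0 ds i
    shift (suc i) _ lt = m∸n+n≡m (pos lt)

  degSeq-greedy : degSeq G ≡ ds
  degSeq-greedy = trans (map-cong degree-greedy (allFin n)) (map-nthOr0 ds)

  -- A parent at m or later would put z at or past `start ds m`. This is the greedy counterpart of
  -- `neighbourhood-bound`, with initial segments as the sets.
  par-< : ∀ {m} → 1 ≤ m → ∀ {z} → toℕ z < start ds m → toℕ (par z) < m
  par-< {m} 1≤m {z} lt with z ≟ root
  ... | yes refl = subst (_< m) (sym (trans (cong toℕ par-root) toℕ-root)) 1≤m
  ... | no z≢ = ≰⇒> λ m≤p → <-irrefl refl (<-≤-trans lt (≤-trans (start-mono ds m≤p) (lower (par-child z≢))))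

  iterate-par-< : ∀ k {m} → 1 ≤ m → ∀ z → toℕ z < (start ds ^[ k ]) m → toℕ ((par ^[ k ]) z) < m
  iterate-par-< zero    1≤m z lt = lt
  iterate-par-< (suc k) 1≤m z lt =
    subst (λ a → toℕ a < _) (sym (iterate-comm par k z)) (par-< 1≤m (iterate-par-< k (s≤s z≤n) z lt))

  iterate-start-≤n : ∀ k {m} → m ≤ n → (start ds ^[ k ]) m ≤ n
  iterate-start-≤n zero    m≤n = m≤n
  iterate-start-≤n (suc k) {m} _ = iterate-start-≤n k (start-≤n m)

  -- From z, go up k steps into the first m vertices, cross among these in at most e steps, and go
  -- down s steps to any u.
  greedy-count : ∀ {m e s} k → 1 ≤ m → m ≤ n → n ≤ (start ds ^[ s ]) m →
    (∀ {a b} → toℕ a < m → toℕ b < m → Within G e a b) →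
    (start ds ^[ k ]) m ≤ countEccLE G (k + (e + s))
  greedy-count {m} {e} {s} k 1≤m m≤n n≤ core = subst (_≤ countEccLE G (k + (e + s)))
    (∑-< (iterate-start-≤n k m≤n)) (∑-mono pointwise)
    where
    central : ∀ z → toℕ z < (start ds ^[ k ]) m → ecc G z ≤ k + (e + s)
    central z lt = Within⇒ecc≤ tree λ u →
      Within-trans (Within-sym (proj₁ tree) (Within-iterate greedy-rooted k z))
        (Within-trans (core (iterate-par-< k 1≤m z lt) (iterate-par-< s 1≤m u (<-≤-trans (toℕ<n u) n≤)))
          (Within-iterate greedy-rooted s u))
      where tree = Rooted⇒IsTree greedy-rooted
    pointwise : ∀ z → ⟦ toℕ z <ᵇ (start ds ^[ k ]) m ⟧ ≤ ⟦ ecc G z ≤ᵇ k + (e + s) ⟧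
    pointwise z with toℕ z <? (start ds ^[ k ]) m
    ... | yes lt = ≤-reflexive (trans (⟦<⟧-yes lt) (sym (⟦⟧-T (≤⇒≤ᵇ (central z lt)))))
    ... | no ≮   = ≤-trans (≤-reflexive (⟦<⟧-no (≮⇒≥ ≮))) z≤n

  greedy-root-core : ∀ {a b} → toℕ a < 1 → toℕ b < 1 → Within G 0 a b
  greedy-root-core {a} {b} a<1 b<1 =
    subst (Within G 0 a) (toℕ-injective (trans (n<1⇒n≡0 a<1) (sym (n<1⇒n≡0 b<1)))) stay

  private
    par-1 : ∀ {v} → v ≢ root → toℕ v < 2 → par v ≡ root
    par-1 v≢ lt = toℕ-injective (trans
      (n<1⇒n≡0 (<-≤-trans (Rooted.rank-par greedy-rooted v≢) (s≤s⁻¹ lt))) (sym toℕ-root))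

  -- The parent of vertex 1 has a smaller label, so it is the root.
  greedy-edge-core : ∀ {a b} → toℕ a < 2 → toℕ b < 2 → Within G 1 a b
  greedy-edge-core {a} {b} a<2 b<2 with a ≟ root | b ≟ root
  ... | yes refl | yes refl = stay
  ... | yes refl | no b≢ = stay ▷ subst (λ w → Adj G w b) (par-1 b≢ b<2) (Rooted.par-adj greedy-rooted b≢)
  ... | no a≢ | yes refl = stay ▷ subst (λ w → Adj G a w) (par-1 a≢ a<2) (Rooted.adj-par greedy-rooted a≢)
  ... | no a≢ | no b≢    = subst (Within G 1 a) (toℕ-injective (trans (is-1 a≢ a<2) (sym (is-1 b≢ b<2)))) stay
    where
    is-1 : ∀ {v} → v ≢ root → toℕ v < 2 → toℕ v ≡ 1
    is-1 v≢ lt = ≤-antisym (s≤s⁻¹ lt) (≢root⇒1≤ v≢)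

-- Minimisation, and the eccentricity sum in terms of counts.

argmin : ∀ {n} (f : Fin (suc n) → ℕ) → ∃ λ c → ∀ v → f c ≤ f v
argmin {zero}  f = zero , λ { zero → ≤-refl }
argmin {suc n} f with argmin (f ∘ suc)
... | c , f-c≤ with f zero ≤? f (suc c)
...   | yes le = zero , λ { zero → ≤-refl ; (suc v) → ≤-trans le (f-c≤ v) }
...   | no ≰   = suc c , λ { zero → ≰⇒≥ ≰ ; (suc v) → f-c≤ v }

complement : ∀ {e n} → e ≤ n → e + ∑ {n} (λ i → ⟦ e ≤ᵇ toℕ i ⟧) ≡ n
complement {e} {n} e≤n = begin
  e + ∑ {n} (λ i → ⟦ e ≤ᵇ toℕ i ⟧)
    ≡⟨ cong (_+ ∑ {n} (λ i → ⟦ e ≤ᵇ toℕ i ⟧)) (∑-< e≤n) ⟨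
  ∑ {n} (λ i → ⟦ toℕ i <ᵇ e ⟧) + ∑ {n} (λ i → ⟦ e ≤ᵇ toℕ i ⟧)
    ≡⟨ ∑-+ {n} (λ i → ⟦ toℕ i <ᵇ e ⟧) (λ i → ⟦ e ≤ᵇ toℕ i ⟧) ⟨
  ∑ {n} (λ i → ⟦ toℕ i <ᵇ e ⟧ + ⟦ e ≤ᵇ toℕ i ⟧)
    ≡⟨ ∑-cong pointwise ⟩
  ∑ {n} (λ _ → 1)
    ≡⟨ ∑-one n ⟩
  n ∎
  where
  open ≡-Reasoning
  pointwise : ∀ (i : Fin n) → ⟦ toℕ i <ᵇ e ⟧ + ⟦ e ≤ᵇ toℕ i ⟧ ≡ 1
  pointwise i with e ≤? toℕ i
  ... | yes le = cong₂ _+_ (⟦<⟧-no le) (⟦⟧-T (≤⇒≤ᵇ le))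
  ... | no ≰   = cong₂ _+_ (⟦<⟧-yes (≰⇒> ≰)) (⟦⟧-¬T (λ t → ≰ (≤ᵇ⇒≤ e (toℕ i) t)))

-- Double counting of pairs (z , ℓ) with ℓ < n: as no eccentricity exceeds n, z contributes n minus
-- its eccentricity to the counts.
Ecc-countEccLE : ∀ {n} (G : Graph n) → Ecc G + ∑ {n} (λ ℓ → countEccLE G (toℕ ℓ)) ≡ n * n
Ecc-countEccLE {n} G = begin
  Ecc G + ∑ {n} (λ ℓ → countEccLE G (toℕ ℓ))
    ≡⟨ cong (Ecc G +_) (∑-swap {n} {n} (λ ℓ z → ⟦ ecc G z ≤ᵇ toℕ ℓ ⟧)) ⟩
  Ecc G + ∑ {n} (λ z → ∑ {n} (λ ℓ → ⟦ ecc G z ≤ᵇ toℕ ℓ ⟧))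
    ≡⟨ ∑-+ (ecc G) (λ z → ∑ {n} (λ ℓ → ⟦ ecc G z ≤ᵇ toℕ ℓ ⟧)) ⟨
  ∑ (λ z → ecc G z + ∑ {n} (λ ℓ → ⟦ ecc G z ≤ᵇ toℕ ℓ ⟧))
    ≡⟨ ∑-cong (λ z → complement (ecc≤n {G = G} z)) ⟩
  ∑ {n} (λ _ → n)
    ≡⟨ ∑-const n n ⟩
  n * n ∎
  where open ≡-Reasoning

Ecc-antitone : ∀ {n} (G H : Graph n) → (∀ ℓ → countEccLE H ℓ ≤ countEccLE G ℓ) → Ecc G ≤ Ecc H
Ecc-antitone {n} G H le = +-cancelʳ-≤ (∑ {n} (λ ℓ → countEccLE G (toℕ ℓ))) _ _ (begin
  Ecc G + ∑ {n} (λ ℓ → countEccLE G (toℕ ℓ))  ≡⟨ trans (Ecc-countEccLE G) (sym (Ecc-countEccLE H)) ⟩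
  Ecc H + ∑ {n} (λ ℓ → countEccLE H (toℕ ℓ))  ≤⟨ +-monoʳ-≤ (Ecc H) (∑-mono {n} λ ℓ → le (toℕ ℓ)) ⟩
  Ecc H + ∑ {n} (λ ℓ → countEccLE G (toℕ ℓ))  ∎)
  where open ≤-Reasoning hiding (start)

-- Comparison with the greedy tree.

countEccLE-≤ : ∀ {n} {G : Graph n} {ℓ} (A : Fin n → Bool) → (∀ z → ecc G z ≤ ℓ → A z ≡ true) →
  countEccLE G ℓ ≤ ∑ (λ z → ⟦ A z ⟧)
countEccLE-≤ {G = G} {ℓ} A h = ∑-mono pointwise
  where
  pointwise : ∀ z → ⟦ ecc G z ≤ᵇ ℓ ⟧ ≤ ⟦ A z ⟧
  pointwise z with ecc G z ≤? ℓ
  ... | yes le = ≤-reflexive (trans (⟦⟧-T (≤⇒≤ᵇ le)) (sym (cong ⟦_⟧ (h z le))))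
  ... | no ≰   = ≤-trans (≤-reflexive (⟦⟧-¬T (λ t → ≰ (≤ᵇ⇒≤ _ ℓ t)))) z≤n

∑-true : ∀ {n} (A : Fin n → Bool) → (∀ x → A x ≡ true) → n ≤ ∑ (λ x → ⟦ A x ⟧)
∑-true {n} A h = ≤-reflexive (trans (sym (∑-one n)) (∑-cong λ x → sym (cong ⟦_⟧ (h x))))

⟦∨⟧-≤ : ∀ a b → ⟦ a ∨ b ⟧ ≤ ⟦ a ⟧ + ⟦ b ⟧
⟦∨⟧-≤ true  b = s≤s z≤n
⟦∨⟧-≤ false b = ≤-refl

module _ {d ds} (sorted : Linked _≥_ (d ∷ ds)) where
  private
    n : ℕ
    n = suc (length ds)

  module _ {G : Graph n} (tree : IsTree G) (perm : degSeq G ↭ d ∷ ds) where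

    private module Gr = Greedy (d ∷ ds) sorted (s≤s z≤n)
                               (positive-tail tree perm refl) (start-total tree perm refl zero)

    greedy-isTree : IsTree (greedy (d ∷ ds))
    greedy-isTree = Rooted⇒IsTree Gr.greedy-rooted

    greedy-degSeq : degSeq (greedy (d ∷ ds)) ↭ d ∷ ds
    greedy-degSeq = ↭-reflexive Gr.degSeq-greedy

    private
      centre = proj₁ (argmin (ecc G))

      r = ecc G centre

      R = distanceRooted tree centre

      open DistanceRooted R using (par; rooted; rank-least)

      spans-centre : Spans G r centre
      spans-centre = ecc≤⇒Within tree ≤-refl

      minimal : ∀ {v s} → Spans G s v → r ≤ s
      minimal {v} sp = ≤-trans (proj₂ (argmin (ecc G)) v) (Within⇒ecc≤ tree sp)

      module _ (A : Fin n → Bool) (A-centre : A centre ≡ true) (A-spans : ∀ x → Spans G r x → A x ≡ true)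
               {m} (A≤m : ∑ (λ x → ⟦ A x ⟧) ≤ m) where

        upper : ∀ k → countEccLE G (k + r) ≤ (start (d ∷ ds) ^[ k ]) m
        upper k = ≤-trans
          (countEccLE-≤ {G = G} (λ x → A ((par ^[ k ]) x)) λ z le →
            spans-iterate R spans-centre A A-centre A-spans k z (ecc≤⇒Within tree le))
          (iterated-bound tree perm refl sorted rooted A A-centre A≤m k)

        cover : ∀ s → (∀ x → A ((par ^[ s ]) x) ≡ true) → n ≤ (start (d ∷ ds) ^[ s ]) m
        cover s h = ≤-trans (∑-true (λ x → A ((par ^[ s ]) x)) h)
          (iterated-bound tree perm refl sorted rooted A A-centre A≤m s)

        -- A is the centre of G, s the number of parent steps that bring every vertex into it, and e
        -- the distance allowed among the first m greedy vertices. Both counts are compared with the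
        -- k-fold `start` of m.
        greedy-beats : ∀ {e s} → 1 ≤ m → m ≤ n → (∀ x → A ((par ^[ s ]) x) ≡ true) →
          (∀ {a b} → toℕ a < m → toℕ b < m → Within (greedy (d ∷ ds)) e a b) → r ≡ e + s →
          ∀ k → countEccLE G (k + r) ≤ countEccLE (greedy (d ∷ ds)) (k + r)
        greedy-beats {e} {s} 1≤m m≤n h core r≡ k = ≤-trans (upper k)
          (subst (λ a → (start (d ∷ ds) ^[ k ]) m ≤ countEccLE (greedy (d ∷ ds)) (k + a)) (sym r≡)
            (Gr.greedy-count {e = e} {s = s} k 1≤m m≤n (cover s h) core))

      distinct⇒2≤ : ∀ {n} {a b : Fin n} → a ≢ b → 2 ≤ n
      distinct⇒2≤ {suc zero}    {zero} {zero} a≢b = contradiction refl a≢b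
      distinct⇒2≤ {suc (suc _)} a≢b = s≤s (s≤s z≤n)

      beyond-radius : ∀ k → countEccLE G (k + r) ≤ countEccLE (greedy (d ∷ ds)) (k + r)
      beyond-radius with any? (λ z → ¬? (z ≟ centre) ×-dec (ecc G z ≤? r))
      -- Unique central vertex: m = 1, e = 0, s = r.
      ... | no none = greedy-beats A (dec-true (centre ≟ centre) refl) only (≤-reflexive (∑-point centre))
              {e = 0} ≤-refl (s≤s z≤n)
              (λ x → dec-true (centre ≟ _) (sym (iterate-≥rank R r x (rank-least (spans-centre x)))))
              Gr.greedy-root-core refl
        where
        A : Fin n → Bool
        A x = does (centre ≟ x)
        only : ∀ x → Spans G r x → A x ≡ true
        only x sp with centre ≟ x
        ... | yes _ = refl
        ... | no ne = contradiction (x , (λ x≡ → ne (sym x≡)) , Within⇒ecc≤ tree sp) none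
      -- Central edge: m = 2, e = 1, s = r - 1.
      ... | yes (z , z≢c , ecc-z) = greedy-beats A (in-A (inj₁ refl))
              (λ x sp → in-A (centre-size tree spans-centre minimal z≢c spans-z sp)) A≤2
              {e = 1} (s≤s z≤n) (distinct⇒2≤ z≢c)
              (λ x → in-A (bicentral-cover R spans-centre minimal z≢c spans-z (proj₂ r-suc) x))
              Gr.greedy-edge-core (proj₂ r-suc)
        where
        spans-z : Spans G r z
        spans-z = ecc≤⇒Within tree ecc-z
        r-suc = radius-suc R spans-centre minimal z≢c spans-z
        A : Fin n → Bool
        A x = does (centre ≟ x) ∨ does (z ≟ x)
        in-A : ∀ {x} → x ≡ centre ⊎ x ≡ z → A x ≡ true
        in-A {x} (inj₁ refl) rewrite dec-true (centre ≟ centre) refl = refl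
        in-A {x} (inj₂ refl) = trans (cong (does (centre ≟ z) ∨_) (dec-true (z ≟ z) refl)) (∨-zeroʳ _)
        A≤2 : ∑ (λ x → ⟦ A x ⟧) ≤ 2
        A≤2 = ≤-trans (∑-mono λ x → ⟦∨⟧-≤ (does (centre ≟ x)) (does (z ≟ x)))
          (≤-reflexive (trans (∑-+ (λ x → ⟦ does (centre ≟ x) ⟧) (λ x → ⟦ does (z ≟ x) ⟧))
            (cong₂ _+_ (∑-point centre) (∑-point z))))

    countEccLE-greedy : ∀ ℓ → countEccLE G ℓ ≤ countEccLE (greedy (d ∷ ds)) ℓ
    countEccLE-greedy ℓ with r ≤? ℓ
    ... | yes r≤ℓ = subst (λ a → countEccLE G a ≤ countEccLE (greedy (d ∷ ds)) a)
                      (m∸n+n≡m r≤ℓ) (beyond-radius (ℓ ∸ r))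
    -- Below the radius no vertex of G is counted.
    ... | no r≰ℓ  = ≤-trans (countEccLE-≤ {G = G} (λ _ → false) λ z le →
                      contradiction (≤-trans (proj₂ (argmin (ecc G)) z) le) r≰ℓ)
                      (≤-trans (≤-reflexive (∑-zero n)) z≤n)

theorem3p8 : (ℓ : ℕ) (ds : List ℕ) → Linked _≥_ ds → TreeDegreeSequence ds →
    IsTree (greedy ds) × (degSeq (greedy ds) ↭ ds)
    × (∀ (T : Graph (length ds)) → IsTree T → degSeq T ↭ ds →
    countEccLE T ℓ ≤ countEccLE (greedy ds) ℓ)
    × (∀ (T : Graph (length ds)) → IsTree T → degSeq T ↭ ds →
    Ecc (greedy ds) ≤ Ecc T)
theorem3p8 ℓ [] _ _ =
  ((λ ()) , (λ ()) , (λ ()) , λ ()) , ↭-reflexive refl ,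
  (λ _ _ _ → z≤n) , (λ _ _ _ → z≤n)
theorem3p8 ℓ (d ∷ ds) sorted (T₀ , tree₀ , perm₀) =
  greedy-isTree sorted tree₀ perm₀ ,
  greedy-degSeq sorted tree₀ perm₀ ,
  (λ T tree perm → countEccLE-greedy sorted tree perm ℓ) ,
  (λ T tree perm → Ecc-antitone (greedy (d ∷ ds)) T (countEccLE-greedy sorted tree perm))
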